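{- There is an absolute constant $c>0$ such that for every positive integer $k$, every $\delta\in(0,1)$ and all sufficiently large $n$, there exist an instance of online weighted bipartite matching with $n$ online and $n$ offline vertices and a probability distribution over arrival orders of the online vertices satisfying the $(k,\delta)$-uniform-induced-ordering property such that the competitive ratio of the Korula–Pál algorithm on this instance (ratio of the optimal matching weight to the expected weight of the algorithm's matching) is at least $c\,\frac{\delta^2}{(k+1)!}\cdot\frac{n}{\ln n}$.
   Context: Online weighted bipartite matching: offline vertices are known in advance; online vertices arrive one at a time in an order $\pi$ drawn from a distribution; upon arrival of an online vertex its incident weighted edges are revealed and the algorithm irrevocably decides which (if any) incident edge to add, maintaining a matching; the objective is total weight. Korula–Pál algorithm: draw $\tau\sim\mathrm{Binom}(n,\frac12)$; the first $\tau$ online vertices are only observed. For each later online vertex $v$, compute a maximum-weight matching in the graph consisting of the offline vertices, the online vertices arrived in rounds $1,\dots,\tau$, and $v$ (ignoring other vertices arrived after round $\tau$); if $v$ is matched in it to an offline vertex $u$ (tentative edge) and $u$ is not yet matched by the algorithm, add the edge $(v,u)$. $(k,\delta)$-uniform-induced-ordering property: for every $k$ distinct online vertices $y_1,\dots,y_k$, $\Pr[\pi(y_1)<\dots<\pi(y_k)]\ge(1-\delta)/k!$, where $\pi(y)$ is the arrival time of $y$.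
   Formalization: The parameter δ ranges over the rational numbers in (0,1) and the absolute constant c is rational; the claim for real δ follows by taking a rational δ′ in (δ/2, δ), with c replaced by c/4. -}

module Defs where

open import Data.Bool.Base using (Bool; true; false; if_then_else_; _∨_; _∧_; not)
open import Data.Nat.Base as ℕ using (ℕ; zero; suc; _<ᵇ_; _!)
open import Data.Fin.Base using (Fin; toℕ)
open import Data.Fin.Properties using () renaming (_≟_ to _≟ᶠ_)
open import Data.Fin.Permutation using (Permutation′; _⟨$⟩ʳ_; _⟨$⟩ˡ_)
open import Data.Integer.Base using (+_)
open import Data.Rational.Base using (ℚ; 0ℚ; 1ℚ; _+_; _*_; _-_; _≤_; _<_; 1/_; ≢-nonZero; _/_)
open import Data.Rational.Properties using (_≟_)
open import Data.List.Base using (List; []; _∷_; foldr; map; allFin; upTo)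
open import Data.Maybe.Base using (Maybe; just; nothing; maybe)
open import Data.Product.Base using (_×_; _,_; proj₁; proj₂)
open import Relation.Nullary.Decidable using (yes; no; does)
open import Relation.Binary.PropositionalEquality using (_≡_)
open import Function.Definitions using (Injective)
open import Data.Unit.Base using (⊤)
open import Data.Nat.Combinatorics using (_C_)

ℕtoℚ : ℕ → ℚ
ℕtoℚ n = + n / 1

-- total reciprocal (0 ↦ 0); only ever applied to nonzero arguments below
inv : ℚ → ℚ
inv q with q ≟ 0ℚ
... | yes _ = 0ℚ
... | no q≢0 = 1/_ q {{≢-nonZero q≢0}}

allB : ∀ {A : Set} → (A → Bool) → List A → Bool
allB p = foldr (λ a b → p a ∧ b) true

sumℚ : List ℚ → ℚ
sumℚ = foldr _+_ 0ℚ

powℚ : ℚ → ℕ → ℚ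
powℚ q zero = 1ℚ
powℚ q (suc j) = q * powℚ q j

expPartial : ℚ → ℕ → ℚ
expPartial y m = sumℚ (map (λ j → powℚ y j * inv (ℕtoℚ (j !))) (upTo m))

-- y ≤ ln n   (for y : ℚ, n ≥ 1), stated as  e^y ≤ n,  i.e. every partial
-- sum of the exponential series at y is ≤ n (exact for y ≥ 0).
LeLn : ℚ → ℕ → Set
LeLn y n = ∀ (m : ℕ) → expPartial y m ≤ ℕtoℚ n

-- Instances: n online vertices (first index) and n offline vertices
-- (second index); adj v u says whether edge (v,u) exists, w v u its weight.

record Instance (n : ℕ) : Set where
  field
    adj : Fin n → Fin n → Bool
    w   : Fin n → Fin n → ℚ
    w≥0 : ∀ v u → 0ℚ ≤ w v u

-- a matching assigns to each online vertex at most one offline vertex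
Matching : ℕ → Set
Matching n = Fin n → Maybe (Fin n)

ValidIn : ∀ {n} → Instance n → (Fin n → Bool) → Matching n → Set
ValidIn {n} I S M =
  (∀ v u → M v ≡ just u → (S v ≡ true) × (Instance.adj I v u ≡ true)) ×
  (∀ v v′ u → M v ≡ just u → M v′ ≡ just u → v ≡ v′)

weight : ∀ {n} → Instance n → Matching n → ℚ
weight {n} I M = sumℚ (map (λ v → maybe (Instance.w I v) 0ℚ (M v)) (allFin n))

-- an arbitrary maximum-weight-matching subroutine (arbitrary tie-breaking)
record MWMOracle {n : ℕ} (I : Instance n) : Set where
  field
    pick    : (Fin n → Bool) → Matching n
    valid   : ∀ S → ValidIn I S (pick S)
    maximum : ∀ S M → ValidIn I S M → weight I M ≤ weight I (pick S)

OPT : ∀ {n} {I : Instance n} → MWMOracle I → ℚ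
OPT {I = I} O = weight I (MWMOracle.pick O (λ _ → true))

-- Korula–Pál with arrival order π (π ⟨$⟩ʳ y = arrival time of y, 0-based)
-- and sample size τ: arrivals at times < τ are only observed.

KPStep : ∀ {n} (I : Instance n) → MWMOracle I → Permutation′ n → ℕ →
         Fin n → ((Fin n → Bool) × ℚ) → ((Fin n → Bool) × ℚ)
KPStep {n} I O π τ t (used , tot) =
  if toℕ t <ᵇ τ then (used , tot) else step (MWMOracle.pick O S)
  where
    v : Fin n
    v = π ⟨$⟩ˡ t
    S : Fin n → Bool
    S y = (toℕ (π ⟨$⟩ʳ y) <ᵇ τ) ∨ does (y ≟ᶠ v)
    step : Matching n → ((Fin n → Bool) × ℚ)
    step M with M v
    ... | nothing = (used , tot)
    ... | just u  = if used u then (used , tot)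
                    else ((λ x → used x ∨ does (x ≟ᶠ u)) , tot + Instance.w I v u)

KPWeight : ∀ {n} (I : Instance n) → MWMOracle I → Permutation′ n → ℕ → ℚ
KPWeight {n} I O π τ =
  proj₂ (foldlF (allFin n) ((λ _ → false) , 0ℚ))
  where
    foldlF : List (Fin n) → ((Fin n → Bool) × ℚ) → ((Fin n → Bool) × ℚ)
    foldlF [] s = s
    foldlF (t ∷ ts) s = foldlF ts (KPStep I O π τ t s)

Dist : ℕ → Set
Dist n = List (ℚ × Permutation′ n)

NonNegList : ∀ {n} → Dist n → Set
NonNegList [] = ⊤
NonNegList (e ∷ D) = (0ℚ ≤ proj₁ e) × NonNegList D

probOf : ∀ {n} → Dist n → (Permutation′ n → Bool) → ℚ
probOf D E = sumℚ (map (λ e → if E (proj₂ e) then proj₁ e else 0ℚ) D)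

IsDist : ∀ {n} → Dist n → Set
IsDist D = NonNegList D × (probOf D (λ _ → true) ≡ 1ℚ)

Ordered : ∀ {n k} → (Fin k → Fin n) → Permutation′ n → Bool
Ordered {n} {k} y π =
  allB (λ i → allB (λ j → not (toℕ i <ᵇ toℕ j) ∨ (toℕ (π ⟨$⟩ʳ y i) <ᵇ toℕ (π ⟨$⟩ʳ y j)))
                 (allFin k))
      (allFin k)

UIO : ∀ {n} → ℕ → ℚ → Dist n → Set
UIO {n} k δ D = ∀ (y : Fin k → Fin n) → Injective _≡_ _≡_ y →
  (1ℚ - δ) * inv (ℕtoℚ (k !)) ≤ probOf D (Ordered y)

binomProb : ℕ → ℕ → ℚ
binomProb n t = ℕtoℚ (n C t) * inv (ℕtoℚ (2 ℕ.^ n))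

ExpKP : ∀ {n} (I : Instance n) → MWMOracle I → Dist n → ℚ
ExpKP {n} I O D =
  sumℚ (map (λ e → proj₁ e *
    sumℚ (map (λ τ → binomProb n τ * KPWeight I O (proj₂ e) τ) (upTo (suc n)))) D)

{-# OPTIONS --safe #-}
module Submission where

-- Take ξ arrival orders P 0, …, P (ξ - 1) and ξ special offline vertices. All but ξ online vertices (which
-- stay isolated) are adjacent to each special vertex j, with weight n + 1 + (arrival time under P j), and to
-- a private offline vertex, with weight n. In order P j, whatever the sample, a vertex arriving after it
-- would beat every sampled vertex at special vertex j, so it is never tentatively matched to its private
-- vertex. Hence the algorithm gains at most 2n from each of ξ vertices, while the optimum is at least n (n - ξ).
--
-- It remains to make ξ = O((k+1)! ln n / δ²) orders (k,δ)-uniform. They are chosen greedily by multiplicative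
-- weights over all k-tuples of vertices: a uniformly random order is increasing on a given tuple with
-- probability 1/k!, so some order is increasing on a 1/k! fraction of the current weight.

open import Defs
open import Data.Bool.Base using (Bool; true; false; if_then_else_; _∨_; _∧_; not)
open import Data.Bool.Properties using (T-≡; ∨-zeroʳ; ∨-identityʳ)
open import Data.Nat.Base as ℕ using (ℕ; zero; suc; z≤n; s≤s; _<ᵇ_; _!; NonZero) renaming (_≤_ to _≤ℕ_)
import Data.Nat.Properties as ℕ
import Data.Nat.DivMod as ℕ
open import Data.Nat.Combinatorics using (_C_; nCk+nC[k+1]≡[n+1]C[k+1])
open import Data.Nat.ListAction using (sum)
open import Data.Nat.ListAction.Properties using (sum-++)
open import Data.Nat.Tactic.RingSolver using (solve-∀)
open import Data.Integer.Base as ℤ using (+[1+_]; -[1+_]) renaming (+_ to pos)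
import Data.Integer.Properties as ℤ
open import Data.Fin.Base as Fin using (Fin; toℕ; fromℕ<; inject≤; punchOut)
import Data.Fin.Properties as Fin
open import Data.Fin.Properties using (_≟_)
open import Data.Fin.Permutation as Perm using (Permutation′; _⟨$⟩ʳ_; _⟨$⟩ˡ_)
import Data.Rational.Properties as ℚ
open import Data.Rational.Unnormalised.Base as ℚᵘ using (mkℚᵘ; *≡*; *≤*)
import Data.Rational.Unnormalised.Properties as ℚᵘ
open import Data.List.Base using (List; []; _∷_; _++_; map; concatMap; length; allFin; upTo)
open import Data.List.Properties using (map-++; map-∘; map-tabulate; map-cong; map-upTo; map-applyUpTo)
open import Data.List.Membership.Propositional using (_∈_)
open import Data.List.Membership.Propositional.Properties using (∈-map⁺; ∈-concatMap⁺; ∈-allFin)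
open import Data.List.Relation.Unary.Any as Any using (here; there)
open import Data.Maybe.Base using (Maybe; just; nothing; maybe)
import Data.Maybe.Properties as Maybe
open import Data.Product.Base using (Σ; ∃; _×_; _,_; proj₁; proj₂)
open import Data.Unit.Base using (tt)
open import Data.Vec.Base using (Vec; []; _∷_; lookup; tabulate)
open import Data.Vec.Properties using (lookup∘tabulate)
open import Function.Base using (_∘_; id)
open import Function.Bundles using (Equivalence)
open import Function.Definitions using (Injective)
open import Level using (0ℓ)
open import Relation.Binary.PropositionalEquality
open import Relation.Nullary using (Dec; yes; no; contradiction)
open import Relation.Nullary.Decidable using (does; dec-true; dec-false; toWitness)
open import Tactic.RingSolver using () renaming (solve-∀ to solveRing-∀)
open import Tactic.RingSolver.Core.AlmostCommutativeRing using (AlmostCommutativeRing; fromCommutativeRing)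

-- One weight function has to mislead the algorithm under every order of the support and for every
-- sample size. Each special vertex does this for one order only, so the loss is governed by the
-- size ξ of the support, and the task becomes to find a (k,δ)-uniform distribution of small
-- support. Independent random orders with a Chernoff bound and a union bound would provide one; the
-- multiplicative weights are that argument derandomised, with averaging as the only trace of
-- probability. The union bound over n^k tuples costs a factor k ln n and a relative deviation δ
-- from probability 1/k! costs k!/δ², so k · k! ≤ (k+1)! explains the shape of the theorem.
--
-- Weights are integers and every exchange gains at least 1, so the tie-breaking of the matching
-- oracle has no influence. The logarithm enters only through powers of two: 2^r ≤ n < 2^(r+1)
-- bounds the number of tuples from above and, by e^(1/2) ≤ 2, ln n from below by r/2.

private variable
  X Y : Set
  n k : ℕ

module Orders where

  open import Data.Nat.Base using (_+_; _*_; _^_; _≤_; _<_)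

  -- Finite sums

  𝟙 : Bool → ℕ
  𝟙 b = if b then 1 else 0

  ∑ : List X → (X → ℕ) → ℕ
  ∑ xs f = sum (map f xs)

  ∑-mono : ∀ (xs : List X) {f g} → (∀ x → f x ≤ g x) → ∑ xs f ≤ ∑ xs g
  ∑-mono []       f≤g = z≤n
  ∑-mono (x ∷ xs) f≤g = ℕ.+-mono-≤ (f≤g x) (∑-mono xs f≤g)

  ∑-cong : ∀ (xs : List X) {f g} → (∀ x → f x ≡ g x) → ∑ xs f ≡ ∑ xs g
  ∑-cong xs f≡g = cong sum (map-cong f≡g xs)

  ∑-+ : ∀ (xs : List X) f g → ∑ xs (λ x → f x + g x) ≡ ∑ xs f + ∑ xs g
  ∑-+ []       f g = refl
  ∑-+ (x ∷ xs) f g rewrite ∑-+ xs f g = lemma (f x) (g x) (∑ xs f) (∑ xs g)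
    where
    lemma : ∀ a b c d → a + b + (c + d) ≡ a + c + (b + d)
    lemma = solve-∀

  ∑-* : ∀ (xs : List X) c f → ∑ xs (λ x → c * f x) ≡ c * ∑ xs f
  ∑-* []       c f = sym (ℕ.*-zeroʳ c)
  ∑-* (x ∷ xs) c f rewrite ∑-* xs c f = sym (ℕ.*-distribˡ-+ c (f x) (∑ xs f))

  ∑-const : ∀ (xs : List X) c → ∑ xs (λ _ → c) ≡ length xs * c
  ∑-const []       c = refl
  ∑-const (x ∷ xs) c = cong (c +_) (∑-const xs c)

  ∑-swap : ∀ (xs : List X) (ys : List Y) (f : X → Y → ℕ) →
    ∑ xs (λ x → ∑ ys (f x)) ≡ ∑ ys (λ y → ∑ xs (λ x → f x y))
  ∑-swap []       ys f = sym (trans (∑-const ys 0) (ℕ.*-zeroʳ (length ys)))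
  ∑-swap (x ∷ xs) ys f rewrite ∑-swap xs ys f = sym (∑-+ ys (f x) _)

  ∑-map : ∀ (h : X → Y) xs f → ∑ (map h xs) f ≡ ∑ xs (f ∘ h)
  ∑-map h xs f = cong sum (sym (map-∘ xs))

  ∑-concatMap : ∀ (h : X → List Y) xs f → ∑ (concatMap h xs) f ≡ ∑ xs (λ x → ∑ (h x) f)
  ∑-concatMap h []       f = refl
  ∑-concatMap h (x ∷ xs) f = begin
    sum (map f (h x ++ concatMap h xs))          ≡⟨ cong sum (map-++ f (h x) _) ⟩
    sum (map f (h x) ++ map f (concatMap h xs))  ≡⟨ sum-++ (map f (h x)) _ ⟩
    ∑ (h x) f + ∑ (concatMap h xs) f             ≡⟨ cong (∑ (h x) f +_) (∑-concatMap h xs f) ⟩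
    ∑ (h x) f + ∑ xs (λ x → ∑ (h x) f)           ∎
    where open ≡-Reasoning

  term≤∑ : ∀ {xs : List X} {x} f → x ∈ xs → f x ≤ ∑ xs f
  term≤∑ {xs = _ ∷ xs} f (here refl) = ℕ.m≤m+n _ _
  term≤∑ {xs = y ∷ xs} f (there x∈)  = ℕ.≤-trans (term≤∑ f x∈) (ℕ.m≤n+m _ (f y))

  ∑-average : ∀ (xs : List X) f c → 0 < length xs → length xs * c ≤ ∑ xs f → ∃ λ x → c ≤ f x
  ∑-average (x ∷ xs) f c _ le with c ℕ.≤? f x
  ... | yes c≤ = x , c≤
  ∑-average (x ∷ []) f c _ le | no c≰ = contradiction
    (subst₂ _≤_ (ℕ.+-identityʳ c) (ℕ.+-identityʳ (f x)) le) c≰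
  ∑-average (x ∷ xs@(_ ∷ _)) f c _ le | no c≰ = ∑-average xs f c (s≤s z≤n)
    (ℕ.+-cancelˡ-≤ c _ _ (ℕ.≤-trans le (ℕ.+-monoˡ-≤ (∑ xs f) (ℕ.<⇒≤ (ℕ.≰⇒> c≰)))))

  ∑-allFin-suc : ∀ (f : Fin (suc n) → ℕ) → ∑ (allFin (suc n)) f ≡ f Fin.zero + ∑ (allFin n) (f ∘ Fin.suc)
  ∑-allFin-suc {n} f = cong (λ xs → f Fin.zero + sum xs)
    (trans (map-tabulate Fin.suc f) (sym (map-tabulate id (f ∘ Fin.suc))))

  ∑-allFin-const : ∀ n c → ∑ (allFin n) (λ _ → c) ≡ n * c
  ∑-allFin-const zero    c = refl
  ∑-allFin-const (suc n) c = trans (∑-allFin-suc {n} (λ _ → c)) (cong (c +_) (∑-allFin-const n c))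

  -- The crosswise form avoids truncated subtraction. It serves indicator sums, exchanges in a
  -- matching and the count of occupied special vertices.
  ∑-update : ∀ (v : Fin n) (f g : Fin n → ℕ) → (∀ x → x ≢ v → g x ≡ f x) →
    ∑ (allFin n) g + f v ≡ ∑ (allFin n) f + g v
  ∑-update {suc n} v f g eq rewrite ∑-allFin-suc f | ∑-allFin-suc g = go v eq
    where
    swap-outer : ∀ a b c → a + b + c ≡ c + b + a
    swap-outer = solve-∀
    go : ∀ v → (∀ x → x ≢ v → g x ≡ f x) →
      g Fin.zero + ∑ (allFin n) (g ∘ Fin.suc) + f v ≡ f Fin.zero + ∑ (allFin n) (f ∘ Fin.suc) + g v
    go Fin.zero eq rewrite ∑-cong (allFin n) {g ∘ Fin.suc} {f ∘ Fin.suc} (λ x → eq (Fin.suc x) λ ()) =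
      swap-outer (g Fin.zero) _ (f Fin.zero)
    go (Fin.suc v) eq rewrite eq Fin.zero (λ ())
      | ℕ.+-assoc (f Fin.zero) (∑ (allFin n) (g ∘ Fin.suc)) (f (Fin.suc v))
      | ℕ.+-assoc (f Fin.zero) (∑ (allFin n) (f ∘ Fin.suc)) (g (Fin.suc v)) =
      cong (f Fin.zero +_) (∑-update v (f ∘ Fin.suc) (g ∘ Fin.suc)
        λ x x≢v → eq (Fin.suc x) (x≢v ∘ Fin.suc-injective))

  𝟙≟-refl : ∀ (x : Fin n) → 𝟙 (does (x ≟ x)) ≡ 1
  𝟙≟-refl x with x ≟ x
  ... | yes _  = refl
  ... | no x≢x = contradiction refl x≢x

  𝟙≟-≢ : ∀ {x y : Fin n} → x ≢ y → 𝟙 (does (x ≟ y)) ≡ 0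
  𝟙≟-≢ {x = x} {y} x≢y with x ≟ y
  ... | yes x≡y = contradiction x≡y x≢y
  ... | no _    = refl

  ∑-𝟙≡ : ∀ (v : Fin n) → ∑ (allFin n) (λ x → 𝟙 (does (x ≟ v))) ≡ 1
  ∑-𝟙≡ {n} v = begin
    ∑ (allFin n) δ         ≡⟨ ℕ.+-identityʳ _ ⟨
    ∑ (allFin n) δ + 0     ≡⟨ ∑-update v (λ _ → 0) δ (λ _ → 𝟙≟-≢) ⟩
    ∑ (allFin n) (λ _ → 0) + δ v ≡⟨ cong₂ _+_ (trans (∑-allFin-const n 0) (ℕ.*-zeroʳ n)) (𝟙≟-refl v) ⟩
    1                      ∎
    where
    open ≡-Reasoning
    δ : Fin n → ℕ
    δ x = 𝟙 (does (x ≟ v))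

  -- Enumeration of tuples and permutations

  vectors : ∀ k n → List (Vec (Fin n) k)
  vectors zero    n = [] ∷ []
  vectors (suc k) n = concatMap (λ x → map (x ∷_) (vectors k n)) (allFin n)

  ∈-vectors : ∀ (v : Vec (Fin n) k) → v ∈ vectors k n
  ∈-vectors []      = here refl
  ∈-vectors {n} {suc k} (x ∷ v) = ∈-concatMap⁺ (λ x → map (x ∷_) (vectors k n))
    (Any.map (λ { refl → ∈-map⁺ (x ∷_) (∈-vectors v) }) (∈-allFin x))

  ∑-vectors : ∀ k n → ∑ (vectors k n) (λ _ → 1) ≡ n ^ k
  ∑-vectors zero    n = refl
  ∑-vectors (suc k) n = begin
    ∑ (vectors (suc k) n) (λ _ → 1)
      ≡⟨ ∑-concatMap (λ x → map (x ∷_) (vectors k n)) (allFin n) _ ⟩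
    ∑ (allFin n) (λ x → ∑ (map (x ∷_) (vectors k n)) (λ _ → 1))
      ≡⟨ ∑-cong (allFin n) (λ x → trans (∑-map (x ∷_) (vectors k n) _) (∑-vectors k n)) ⟩
    ∑ (allFin n) (λ _ → n ^ k)
      ≡⟨ ∑-allFin-const n _ ⟩
    n * n ^ k ∎
    where open ≡-Reasoning

  -- The enumeration is by the vertex `x` that arrives at time 0, which makes conditioning on the
  -- first arrival a mere splitting of the sum.
  permutations : ∀ n → List (Permutation′ n)
  permutations zero    = Perm.id ∷ []
  permutations (suc n) = concatMap (λ x → map (Perm.insert x Fin.zero) (permutations n)) (allFin (suc n))

  ∑-permutations-suc : ∀ n f → ∑ (permutations (suc n)) f ≡
    ∑ (allFin (suc n)) (λ x → ∑ (permutations n) (λ π → f (Perm.insert x Fin.zero π)))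
  ∑-permutations-suc n f = trans
    (∑-concatMap (λ x → map (Perm.insert x Fin.zero) (permutations n)) (allFin (suc n)) f)
    (∑-cong (allFin (suc n)) (λ x → ∑-map (Perm.insert x Fin.zero) (permutations n) f))

  ∑-permutations : ∀ n c → ∑ (permutations n) (λ _ → c) ≡ n ! * c
  ∑-permutations zero    c = refl
  ∑-permutations (suc n) c = begin
    ∑ (permutations (suc n)) (λ _ → c)                              ≡⟨ ∑-permutations-suc n _ ⟩
    ∑ (allFin (suc n)) (λ _ → ∑ (permutations n) (λ _ → c))  ≡⟨ ∑-allFin-const (suc n) _ ⟩
    suc n * ∑ (permutations n) (λ _ → c)                     ≡⟨ cong (suc n *_) (∑-permutations n c) ⟩
    suc n * (n ! * c)                                        ≡⟨ ℕ.*-assoc (suc n) (n !) c ⟨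
    suc n ! * c                                              ∎
    where open ≡-Reasoning

  length-permutations : ∀ n → length (permutations n) ≡ n !
  length-permutations n = begin
    length (permutations n)             ≡⟨ ℕ.*-identityʳ _ ⟨
    length (permutations n) * 1         ≡⟨ ∑-const (permutations n) 1 ⟨
    ∑ (permutations n) (λ _ → 1)        ≡⟨ ∑-permutations n 1 ⟩
    n ! * 1                             ≡⟨ ℕ.*-identityʳ _ ⟩
    n !                                 ∎
    where open ≡-Reasoning

  ^-distribʳ-* : ∀ p m n → (m * n) ^ p ≡ m ^ p * n ^ p
  ^-distribʳ-* zero    m n = refl
  ^-distribʳ-* (suc p) m n = trans (cong (m * n *_) (^-distribʳ-* p m n)) (ℕ.[m*n]*[o*p]≡[m*o]*[n*p] m n (m ^ p) (n ^ p))

  hits : (ℕ → Bool) → ℕ → ℕ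
  hits b zero    = 0
  hits b (suc t) = 𝟙 (b t) + hits b t

  -- Random orders

  <⇒<ᵇ≡true : ∀ {m n} → m < n → (m <ᵇ n) ≡ true
  <⇒<ᵇ≡true m<n = Equivalence.to T-≡ (ℕ.<⇒<ᵇ m<n)

  <ᵇ≡true⇒< : ∀ m n → (m <ᵇ n) ≡ true → m < n
  <ᵇ≡true⇒< m n eq = ℕ.<ᵇ⇒< m n (Equivalence.from T-≡ eq)

  allB⁺ : ∀ {p : X → Bool} xs → (∀ x → p x ≡ true) → allB p xs ≡ true
  allB⁺ []       h = refl
  allB⁺ (x ∷ xs) h rewrite h x = allB⁺ xs h

  allB⁻ : ∀ {p : X → Bool} {xs x} → allB p xs ≡ true → x ∈ xs → p x ≡ true
  allB⁻ {p = p} {xs = z ∷ zs} eq x∈ with p z in pz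
  allB⁻ eq (here refl) | true = pz
  allB⁻ eq (there x∈)  | true = allB⁻ eq x∈

  Increasing : (Fin k → Fin n) → Permutation′ n → Set
  Increasing y π = ∀ i j → toℕ i < toℕ j → toℕ (π ⟨$⟩ʳ y i) < toℕ (π ⟨$⟩ʳ y j)

  Ordered⁺ : ∀ (y : Fin k → Fin n) π → Increasing y π → Ordered y π ≡ true
  Ordered⁺ {k} y π inc = allB⁺ (allFin k) λ i → allB⁺ (allFin k) λ j → clause i j
    where
    clause : ∀ i j → (not (toℕ i <ᵇ toℕ j) ∨ (toℕ (π ⟨$⟩ʳ y i) <ᵇ toℕ (π ⟨$⟩ʳ y j))) ≡ true
    clause i j with toℕ i <ᵇ toℕ j in eq
    ... | false = refl
    ... | true  = <⇒<ᵇ≡true (inc i j (<ᵇ≡true⇒< (toℕ i) (toℕ j) eq))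

  Ordered⁻ : ∀ (y : Fin k → Fin n) π → Ordered y π ≡ true → Increasing y π
  Ordered⁻ y π ord i j i<j with clause ← allB⁻ (allB⁻ ord (∈-allFin i)) (∈-allFin j)
    rewrite <⇒<ᵇ≡true i<j = <ᵇ≡true⇒< _ _ clause

  Ordered-cong : ∀ {y z : Fin k → Fin n} π → (∀ i → y i ≡ z i) → Ordered y π ≡ true → Ordered z π ≡ true
  Ordered-cong {y = y} {z} π y≡z ord = Ordered⁺ z π λ i j i<j →
    subst₂ (λ a b → toℕ (π ⟨$⟩ʳ a) < toℕ (π ⟨$⟩ʳ b)) (y≡z i) (y≡z j) (Ordered⁻ y π ord i j i<j)

  𝟙-mono : ∀ {b c} → (b ≡ true → c ≡ true) → 𝟙 b ≤ 𝟙 c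
  𝟙-mono {false}         _ = z≤n
  𝟙-mono {true}  {true}  _ = ℕ.≤-refl
  𝟙-mono {true}  {false} h with () ← h refl

  insert-self : ∀ (x : Fin (suc n)) j (π : Permutation′ n) → Perm.insert x j π ⟨$⟩ʳ x ≡ j
  insert-self x j π with x ≟ x
  ... | yes _  = refl
  ... | no x≢x = contradiction refl x≢x

  module _ {x : Fin (suc n)} {y : Fin k → Fin (suc n)} (x∉y : ∀ i → x ≢ y i) where

    delete : Fin k → Fin n
    delete i = punchOut (x∉y i)

    delete-injective : Injective _≡_ _≡_ y → Injective _≡_ _≡_ delete
    delete-injective inj eq = inj (Fin.punchOut-injective (x∉y _) (x∉y _) eq)

    insert-delete : ∀ (π : Permutation′ n) i → Perm.insert x Fin.zero π ⟨$⟩ʳ y i ≡ Fin.suc (π ⟨$⟩ʳ delete i)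
    insert-delete π i = trans
      (cong (Perm.insert x Fin.zero π ⟨$⟩ʳ_) (sym (Fin.punchIn-punchOut (x∉y i))))
      (Perm.insert-punchIn x Fin.zero π (delete i))

    Increasing-insert : ∀ π → Increasing delete π → Increasing y (Perm.insert x Fin.zero π)
    Increasing-insert π inc i j i<j = subst₂ (λ a b → toℕ a < toℕ b)
      (sym (insert-delete π i)) (sym (insert-delete π j)) (s≤s (inc i j i<j))

  Increasing-insert-head : ∀ {y : Fin (suc k) → Fin (suc n)} (y₀∉ : ∀ i → y Fin.zero ≢ y (Fin.suc i)) π →
    Increasing (delete y₀∉) π → Increasing y (Perm.insert (y Fin.zero) Fin.zero π)
  Increasing-insert-head {y = y} y₀∉ π inc Fin.zero (Fin.suc j) _ = subst₂ (λ a b → toℕ a < toℕ b)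
    (sym (insert-self (y Fin.zero) Fin.zero π)) (sym (insert-delete y₀∉ π j)) (s≤s z≤n)
  Increasing-insert-head y₀∉ π inc (Fin.suc i) (Fin.suc j) (s≤s i<j) = Increasing-insert y₀∉ π inc i j i<j

  -- Condition on the vertex x arriving first: with δ the Kronecker symbol, the term of x is at least
  -- n! (k+1) for x = y 0, at least 0 for the other x = y i, and at least n! for all remaining x.
  ordered-frequency : ∀ n k (y : Fin k → Fin n) → Injective _≡_ _≡_ y →
    n ! ≤ k ! * ∑ (permutations n) (𝟙 ∘ Ordered y)
  ordered-frequency n       zero    y inj rewrite ∑-permutations n 1 | ℕ.*-identityʳ (n !) =
    ℕ.≤-reflexive (sym (ℕ.+-identityʳ _))
  ordered-frequency zero    (suc k) y inj with () ← y Fin.zero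
  -- The surplus `n ! * k` at `x = y 0` balances the `k` missing terms at the other entries of `y`;
  -- adding it on both sides avoids subtraction.
  ordered-frequency (suc n) (suc k) y inj = ℕ.+-cancelʳ-≤ (n ! * k) _ _ (begin
    suc n ! + n ! * k
      ≡⟨ arith (n !) n k ⟩
    n ! * (suc n * 1 + k * 1)
      ≡⟨ cong₂ (λ a b → n ! * (a + k * b)) (∑-allFin-const (suc n) 1) (∑-𝟙≡ (y Fin.zero)) ⟨
    n ! * (∑ F (λ _ → 1) + k * ∑ F (λ x → δ x (y Fin.zero)))
      ≡⟨ cong (λ s → n ! * (∑ F (λ _ → 1) + s)) (∑-* F k _) ⟨
    n ! * (∑ F (λ _ → 1) + ∑ F (λ x → k * δ x (y Fin.zero)))
      ≡⟨ cong (n ! *_) (∑-+ F (λ _ → 1) _) ⟨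
    n ! * ∑ F (λ x → 1 + k * δ x (y Fin.zero))
      ≡⟨ ∑-* F (n !) _ ⟨
    ∑ F (λ x → n ! * (1 + k * δ x (y Fin.zero)))
      ≤⟨ ∑-mono F first ⟩
    ∑ F (λ x → suc k ! * C x + n ! * ∑ (allFin k) (λ i → δ x (y (Fin.suc i))))
      ≡⟨ ∑-+ F (λ x → suc k ! * C x) _ ⟩
    ∑ F (λ x → suc k ! * C x) + ∑ F (λ x → n ! * ∑ (allFin k) (λ i → δ x (y (Fin.suc i))))
      ≡⟨ cong₂ _+_ (∑-* F (suc k !) C) (∑-* F (n !) _) ⟩
    suc k ! * ∑ F C + n ! * ∑ F (λ x → ∑ (allFin k) (λ i → δ x (y (Fin.suc i))))
      ≡⟨ cong (λ s → suc k ! * ∑ F C + n ! * s) (∑-swap F (allFin k) (λ x i → δ x (y (Fin.suc i)))) ⟩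
    suc k ! * ∑ F C + n ! * ∑ (allFin k) (λ i → ∑ F (λ x → δ x (y (Fin.suc i))))
      ≡⟨ cong (λ s → suc k ! * ∑ F C + n ! * s) (∑-cong (allFin k) (λ i → ∑-𝟙≡ (y (Fin.suc i)))) ⟩
    suc k ! * ∑ F C + n ! * ∑ (allFin k) (λ _ → 1)
      ≡⟨ cong (λ s → suc k ! * ∑ F C + n ! * s) (trans (∑-allFin-const k 1) (ℕ.*-identityʳ k)) ⟩
    suc k ! * ∑ F C + n ! * k
      ≡⟨ cong (λ s → suc k ! * s + n ! * k) (∑-permutations-suc n (𝟙 ∘ Ordered y)) ⟨
    suc k ! * ∑ (permutations (suc n)) (𝟙 ∘ Ordered y) + n ! * k
      ∎)
    where
    open ℕ.≤-Reasoning
    F : List (Fin (suc n))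
    F = allFin (suc n)
    δ : Fin (suc n) → Fin (suc n) → ℕ
    δ x z = 𝟙 (does (x ≟ z))
    C : Fin (suc n) → ℕ
    C x = ∑ (permutations n) (λ π → 𝟙 (Ordered y (Perm.insert x Fin.zero π)))
    arith : ∀ f n k → (f + n * f) + f * k ≡ f * (suc n * 1 + k * 1)
    arith = solve-∀

    first : ∀ x → n ! * (1 + k * δ x (y Fin.zero)) ≤ suc k ! * C x + n ! * ∑ (allFin k) (λ i → δ x (y (Fin.suc i)))
    first x = split (x ≟ y Fin.zero) (Fin.any? (λ i → x ≟ y (Fin.suc i)))
      where
      split : Dec (x ≡ y Fin.zero) → Dec (∃ λ i → x ≡ y (Fin.suc i)) →
        n ! * (1 + k * δ x (y Fin.zero)) ≤ suc k ! * C x + n ! * ∑ (allFin k) (λ i → δ x (y (Fin.suc i)))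
      split (yes refl) _ = ℕ.m≤n⇒m≤n+o _ (begin
        n ! * (1 + k * δ x x)   ≡⟨ cong (λ s → n ! * (1 + k * s)) (𝟙≟-refl x) ⟩
        n ! * (1 + k * 1)       ≡⟨ trans (ℕ.*-comm (n !) _) (cong (λ s → suc s * n !) (ℕ.*-identityʳ k)) ⟩
        suc k * n !             ≤⟨ ℕ.*-monoʳ-≤ (suc k) (ordered-frequency n k (delete y₀∉) (delete-injective y₀∉ (Fin.suc-injective ∘ inj))) ⟩
        suc k * (k ! * ∑ (permutations n) (𝟙 ∘ Ordered (delete y₀∉)))
                                ≤⟨ ℕ.*-monoʳ-≤ (suc k) (ℕ.*-monoʳ-≤ (k !) (∑-mono (permutations n) λ π → 𝟙-mono λ ord →
                                     Ordered⁺ y (Perm.insert x Fin.zero π) (Increasing-insert-head {y = y} y₀∉ π (Ordered⁻ (delete y₀∉) π ord)))) ⟩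
        suc k * (k ! * C x)     ≡⟨ ℕ.*-assoc (suc k) (k !) (C x) ⟨
        suc k ! * C x           ∎)
        where
        y₀∉ : ∀ i → y Fin.zero ≢ y (Fin.suc i)
        y₀∉ i eq with () ← inj eq
      split (no x≢y₀) (yes (i , refl)) = ℕ.m≤n⇒m≤o+n _ (ℕ.*-monoʳ-≤ (n !) (begin
        1 + k * δ x (y Fin.zero)                       ≡⟨ cong (λ s → 1 + k * s) (𝟙≟-≢ x≢y₀) ⟩
        1 + k * 0                                      ≡⟨ cong suc (ℕ.*-zeroʳ k) ⟩
        1                                              ≡⟨ 𝟙≟-refl x ⟨
        δ x (y (Fin.suc i))                            ≤⟨ term≤∑ (λ i → δ x (y (Fin.suc i))) (∈-allFin i) ⟩
        ∑ (allFin k) (λ i → δ x (y (Fin.suc i)))       ∎))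
      split (no x≢y₀) (no ∄i) = ℕ.m≤n⇒m≤n+o _ (begin
        n ! * (1 + k * δ x (y Fin.zero))  ≡⟨ cong (λ s → n ! * (1 + k * s)) (𝟙≟-≢ x≢y₀) ⟩
        n ! * (1 + k * 0)    ≡⟨ trans (cong (λ s → n ! * suc s) (ℕ.*-zeroʳ k)) (ℕ.*-identityʳ (n !)) ⟩
        n !                  ≤⟨ ordered-frequency n (suc k) (delete x∉) (delete-injective x∉ inj) ⟩
        suc k ! * ∑ (permutations n) (𝟙 ∘ Ordered (delete x∉))
                             ≤⟨ ℕ.*-monoʳ-≤ (suc k !) (∑-mono (permutations n) λ π → 𝟙-mono λ ord →
                                  Ordered⁺ y (Perm.insert x Fin.zero π) (Increasing-insert x∉ π (Ordered⁻ (delete x∉) π ord))) ⟩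
        suc k ! * C x        ∎)
        where
        x∉ : ∀ i → x ≢ y i
        x∉ Fin.zero    = x≢y₀
        x∉ (Fin.suc i) = λ eq → ∄i (i , eq)

  -- Multiplicative weights

  -- Every round plays an outcome whose event weight is at least average, and then multiplies
  -- the weight of every y by a if its event occurred and by suc a if it did not.
  module MultiplicativeWeights {X Y : Set} (xs : List X) (xs≢[] : 0 < length xs) (ys : List Y)
    (E : Y → X → Bool) (K a q : ℕ) (K[1+a]≡1+q : K * suc a ≡ suc q) where

    frequency : Y → ℕ
    frequency y = ∑ xs (𝟙 ∘ E y)

    Frequent : Y → Set
    Frequent y = length xs ≤ K * frequency y

    frequent? : ∀ y → Dec (Frequent y)
    frequent? y = length xs ℕ.≤? K * frequency y

    -- `Frequent y` multiplied by the weight of `y`, hence vacuous at weight 0. Infrequent `y` start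
    -- with weight 0 and never influence a choice; in the application these are the tuples with a
    -- repeated entry.
    Fair : (Y → ℕ) → Set
    Fair W = ∀ y → length xs * W y ≤ K * (frequency y * W y)

    best : ∀ W → Fair W → ∃ λ x → ∑ ys W ≤ K * ∑ ys (λ y → W y * 𝟙 (E y x))
    best W fair = ∑-average xs _ _ xs≢[] (begin
      length xs * ∑ ys W                                    ≡⟨ ∑-* ys (length xs) W ⟨
      ∑ ys (λ y → length xs * W y)                          ≤⟨ ∑-mono ys fair ⟩
      ∑ ys (λ y → K * (frequency y * W y))                  ≡⟨ ∑-* ys K _ ⟩
      K * ∑ ys (λ y → frequency y * W y)                    ≡⟨ cong (K *_) (∑-cong ys λ y →
                                                                 trans (ℕ.*-comm (frequency y) (W y)) (sym (∑-* xs (W y) _))) ⟩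
      K * ∑ ys (λ y → ∑ xs (λ x → W y * 𝟙 (E y x)))         ≡⟨ cong (K *_) (∑-swap ys xs _) ⟩
      K * ∑ xs (λ x → ∑ ys (λ y → W y * 𝟙 (E y x)))         ≡⟨ ∑-* xs K _ ⟨
      ∑ xs (λ x → K * ∑ ys (λ y → W y * 𝟙 (E y x)))         ∎)
      where open ℕ.≤-Reasoning

    factor : Y → X → ℕ
    factor y x = if E y x then a else suc a

    scale-fair : ∀ c l f w → l * w ≤ K * (f * w) → l * (c * w) ≤ K * (f * (c * w))
    scale-fair c l f w le = subst₂ _≤_ (left c l w) (right c K f w) (ℕ.*-monoʳ-≤ c le)
      where
      left : ∀ c l w → c * (l * w) ≡ l * (c * w)
      left = solve-∀
      right : ∀ c K f w → c * (K * (f * w)) ≡ K * (f * (c * w))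
      right = solve-∀

    initial : ∀ {P : Set} → Dec P → ℕ
    initial P? = 𝟙 (does P?)

    initial-true : ∀ {P : Set} (P? : Dec P) → P → initial P? ≡ 1
    initial-true (yes _) _ = refl
    initial-true (no ¬p) p = contradiction p ¬p

    initial≤1 : ∀ {P : Set} (P? : Dec P) → initial P? ≤ 1
    initial≤1 (yes _) = ℕ.≤-refl
    initial≤1 (no _)  = z≤n

    -- Fairness is carried along because the choice made in each round, and thus the next weight
    -- function, depends on its proof.
    weights : ℕ → Σ (Y → ℕ) Fair
    weights zero = initial ∘ frequent? , λ y → fair y (frequent? y)
      where
      fair : ∀ y (d : Dec (Frequent y)) → length xs * initial d ≤ K * (frequency y * initial d)
      fair y (yes p) = subst₂ _≤_ (sym (ℕ.*-identityʳ _)) (cong (K *_) (sym (ℕ.*-identityʳ _))) p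
      fair y (no _)  = ℕ.≤-trans (ℕ.≤-reflexive (ℕ.*-zeroʳ (length xs))) z≤n
    weights (suc t) = (λ y → factor y (proj₁ (best W fair)) * W y) ,
      λ y → scale-fair (factor y (proj₁ (best W fair))) (length xs) (frequency y) (W y) (fair y)
      where
      W = proj₁ (weights t)
      fair = proj₂ (weights t)

    W : ℕ → Y → ℕ
    W t = proj₁ (weights t)

    choice : ℕ → X
    choice t = proj₁ (best (W t) (proj₂ (weights t)))

    count : ℕ → Y → ℕ
    count t y = hits (λ s → E y (choice s)) t

    -- Multiplying everything by `suc a` and removing the hit weight once gives the new total. The
    -- hit weight is at least a 1/K fraction of the old total, so K times the new total is at most K
    -- (a + 1) - 1 = q times the old one.
    total-decrease : ∀ t → K * ∑ ys (W (suc t)) ≤ q * ∑ ys (W t)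
    total-decrease t = ℕ.+-cancelʳ-≤ (∑ ys (W t)) _ _ (begin
      K * ∑ ys (W (suc t)) + ∑ ys (W t)          ≤⟨ ℕ.+-monoʳ-≤ (K * ∑ ys (W (suc t))) (proj₂ (best (W t) (proj₂ (weights t)))) ⟩
      K * ∑ ys (W (suc t)) + K * ∑ ys hit        ≡⟨ ℕ.*-distribˡ-+ K (∑ ys (W (suc t))) (∑ ys hit) ⟨
      K * (∑ ys (W (suc t)) + ∑ ys hit)          ≡⟨ cong (K *_) (∑-+ ys (W (suc t)) hit) ⟨
      K * ∑ ys (λ y → W (suc t) y + hit y)       ≡⟨ cong (K *_) (∑-cong ys split) ⟩
      K * ∑ ys (λ y → suc a * W t y)             ≡⟨ cong (K *_) (∑-* ys (suc a) (W t)) ⟩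
      K * (suc a * ∑ ys (W t))                   ≡⟨ ℕ.*-assoc K (suc a) _ ⟨
      K * suc a * ∑ ys (W t)                     ≡⟨ cong (_* ∑ ys (W t)) K[1+a]≡1+q ⟩
      suc q * ∑ ys (W t)                         ≡⟨ ℕ.+-comm (∑ ys (W t)) _ ⟩
      q * ∑ ys (W t) + ∑ ys (W t)                ∎)
      where
      open ℕ.≤-Reasoning
      hit : Y → ℕ
      hit y = W t y * 𝟙 (E y (choice t))
      split-on : ∀ b w → (if b then a else suc a) * w + w * 𝟙 b ≡ suc a * w
      split-on true  w = trans (cong (a * w +_) (ℕ.*-identityʳ w)) (ℕ.+-comm (a * w) w)
      split-on false w = trans (cong (suc a * w +_) (ℕ.*-zeroʳ w)) (ℕ.+-identityʳ _)
      split : ∀ y → W (suc t) y + hit y ≡ suc a * W t y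
      split y = split-on (E y (choice t)) (W t y)

    total≤ : ∀ t → K ^ t * ∑ ys (W t) ≤ q ^ t * length ys
    total≤ zero = ℕ.*-monoʳ-≤ 1 (begin
      ∑ ys (W 0)         ≤⟨ ∑-mono ys (initial≤1 ∘ frequent?) ⟩
      ∑ ys (λ _ → 1)     ≡⟨ trans (∑-const ys 1) (ℕ.*-identityʳ _) ⟩
      length ys          ∎)
      where
      open ℕ.≤-Reasoning
    total≤ (suc t) = begin
      K * K ^ t * ∑ ys (W (suc t))     ≡⟨ shuffle K (K ^ t) _ ⟩
      K ^ t * (K * ∑ ys (W (suc t)))   ≤⟨ ℕ.*-monoʳ-≤ (K ^ t) (total-decrease t) ⟩
      K ^ t * (q * ∑ ys (W t))         ≡⟨ shuffle′ (K ^ t) q _ ⟩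
      q * (K ^ t * ∑ ys (W t))         ≤⟨ ℕ.*-monoʳ-≤ q (total≤ t) ⟩
      q * (q ^ t * length ys)          ≡⟨ ℕ.*-assoc q (q ^ t) _ ⟨
      q * q ^ t * length ys            ∎
      where
      open ℕ.≤-Reasoning
      shuffle : ∀ a b c → a * b * c ≡ b * (a * c)
      shuffle = solve-∀
      shuffle′ : ∀ a b c → a * (b * c) ≡ b * (a * c)
      shuffle′ = solve-∀

    -- The weight is a^c (a + 1)^(t - c) with c hits among t rounds, multiplied through by (a + 1)^c
    -- to avoid the difference.
    weight-count : ∀ {y} → Frequent y → ∀ t → W t y * suc a ^ count t y ≡ a ^ count t y * suc a ^ t
    weight-count {y} freq zero = cong (_* 1) (initial-true (frequent? y) freq)
    weight-count {y} freq (suc t) = on (E y (choice t))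
      where
      c = count t y
      miss-arith : ∀ s w p → s * w * p ≡ s * (w * p)
      miss-arith = solve-∀
      hit-arith : ∀ x s w p → x * w * (s * p) ≡ x * s * (w * p)
      hit-arith = solve-∀
      hit-arith′ : ∀ x s w p → x * s * (w * p) ≡ x * w * (s * p)
      hit-arith′ = solve-∀
      on : ∀ b → (if b then a else suc a) * W t y * suc a ^ (𝟙 b + c) ≡ a ^ (𝟙 b + c) * (suc a * suc a ^ t)
      on true  = trans (hit-arith a (suc a) (W t y) (suc a ^ c))
        (trans (cong (a * suc a *_) (weight-count freq t)) (hit-arith′ a (suc a) (a ^ c) (suc a ^ t)))
      on false = trans (miss-arith (suc a) (W t y) (suc a ^ c))
        (trans (cong (suc a *_) (weight-count freq t)) (miss-arith′ (suc a) (a ^ c) (suc a ^ t)))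
        where
        miss-arith′ : ∀ s w p → s * (w * p) ≡ w * (s * p)
        miss-arith′ = solve-∀

    -- A single weight is at most the total: a `y` with few hits would retain more weight than all
    -- of `ys` together.
    count-bound : ∀ {y} → y ∈ ys → Frequent y → ∀ t →
      (K * suc a) ^ t * a ^ count t y ≤ q ^ t * length ys * suc a ^ count t y
    count-bound {y} y∈ freq t = begin
      (K * suc a) ^ t * a ^ c            ≡⟨ cong (_* a ^ c) (^-distribʳ-* t K (suc a)) ⟩
      K ^ t * suc a ^ t * a ^ c          ≡⟨ rearrange (K ^ t) _ _ ⟩
      K ^ t * (a ^ c * suc a ^ t)        ≡⟨ cong (K ^ t *_) (weight-count freq t) ⟨
      K ^ t * (W t y * suc a ^ c)        ≤⟨ ℕ.*-monoʳ-≤ (K ^ t) (ℕ.*-monoˡ-≤ (suc a ^ c) (term≤∑ (W t) y∈)) ⟩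
      K ^ t * (∑ ys (W t) * suc a ^ c)   ≡⟨ ℕ.*-assoc (K ^ t) _ _ ⟨
      K ^ t * ∑ ys (W t) * suc a ^ c     ≤⟨ ℕ.*-monoˡ-≤ (suc a ^ c) (total≤ t) ⟩
      q ^ t * length ys * suc a ^ c      ∎
      where
      open ℕ.≤-Reasoning
      c = count t y
      rearrange : ∀ a b c → a * b * c ≡ a * (c * b)
      rearrange = solve-∀

    -- With c < T hits, `count-bound` at c combined with the reverse inequality at T would give (a +
    -- 1)^(T - c) ≤ a^(T - c).
    count≥ : .{{_ : NonZero a}} → ∀ {y} → y ∈ ys → Frequent y → ∀ t T →
      q ^ t * length ys * suc a ^ T ≤ (K * suc a) ^ t * a ^ T → T ≤ count t y
    count≥ {y} y∈ freq t T bound with T ℕ.≤? count t y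
    ... | yes T≤ = T≤
    ... | no T≰ with s , refl ← ℕ.m≤n⇒∃[o]m+o≡n (ℕ.≰⇒> T≰) = contradiction powers (ℕ.<⇒≱ (ℕ.^-monoˡ-< (suc s) (ℕ.n<1+n a)))
      where
      open ℕ.≤-Reasoning
      c = count t y
      instance
        Ka≢0 : NonZero (K * suc a)
        Ka≢0 = subst NonZero (sym K[1+a]≡1+q) _
        p≢0 : NonZero ((K * suc a) ^ t)
        p≢0 = ℕ.m^n≢0 (K * suc a) t
        a^c≢0 : NonZero (a ^ c)
        a^c≢0 = ℕ.m^n≢0 a c
        A^c≢0 : NonZero (suc a ^ c)
        A^c≢0 = ℕ.m^n≢0 (suc a) c
        prod≢0 : NonZero ((K * suc a) ^ t * (a ^ c * suc a ^ c))
        prod≢0 = ℕ.m*n≢0 ((K * suc a) ^ t) (a ^ c * suc a ^ c) {{p≢0}} {{ℕ.m*n≢0 (a ^ c) (suc a ^ c)}}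
      s+c : suc (c + s) ≡ c + suc s
      s+c = sym (ℕ.+-suc c s)
      ar₁ : ∀ p x y z → p * (x * y) * z ≡ p * x * (y * z)
      ar₁ = solve-∀
      ar₂ : ∀ q A B → q * A * B ≡ q * B * A
      ar₂ = solve-∀
      ar₃ : ∀ p x y z → p * (x * y) * z ≡ p * (x * z) * y
      ar₃ = solve-∀
      powers : suc a ^ suc s ≤ a ^ suc s
      powers = ℕ.*-cancelˡ-≤ ((K * suc a) ^ t * (a ^ c * suc a ^ c)) (begin
        (K * suc a) ^ t * (a ^ c * suc a ^ c) * suc a ^ suc s
          ≡⟨ ar₁ ((K * suc a) ^ t) (a ^ c) _ _ ⟩
        (K * suc a) ^ t * a ^ c * (suc a ^ c * suc a ^ suc s)
          ≡⟨ cong ((K * suc a) ^ t * a ^ c *_) (trans (cong (suc a ^_) s+c) (ℕ.^-distribˡ-+-* (suc a) c (suc s))) ⟨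
        (K * suc a) ^ t * a ^ c * suc a ^ suc (c + s)
          ≤⟨ ℕ.*-monoˡ-≤ (suc a ^ suc (c + s)) (count-bound y∈ freq t) ⟩
        q ^ t * length ys * suc a ^ c * suc a ^ suc (c + s)
          ≡⟨ ar₂ (q ^ t * length ys) _ _ ⟩
        q ^ t * length ys * suc a ^ suc (c + s) * suc a ^ c
          ≤⟨ ℕ.*-monoˡ-≤ (suc a ^ c) bound ⟩
        (K * suc a) ^ t * a ^ suc (c + s) * suc a ^ c
          ≡⟨ cong (λ z → (K * suc a) ^ t * z * suc a ^ c) (trans (cong (a ^_) s+c) (ℕ.^-distribˡ-+-* a c (suc s))) ⟩
        (K * suc a) ^ t * (a ^ c * a ^ suc s) * suc a ^ c
          ≡⟨ ar₃ ((K * suc a) ^ t) (a ^ c) _ _ ⟩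
        (K * suc a) ^ t * (a ^ c * suc a ^ c) * a ^ suc s
          ∎)

  -- Bernoulli inequalities and the decay of the potential

  -- (1 - 1/Z)^m ≤ 1/(1 + m/Z) for Z = 1 + q
  pred-power-upper : ∀ q m → q ^ m * (suc q + m) ≤ suc q ^ suc m
  pred-power-upper q zero    = ℕ.≤-reflexive (zero-case q)
    where
    zero-case : ∀ q → 1 * (suc q + 0) ≡ suc q * 1
    zero-case = solve-∀
  pred-power-upper q (suc m) = begin
    q * q ^ m * (suc q + suc m)               ≡⟨ ℕ.*-assoc q (q ^ m) _ ⟩
    q * (q ^ m * (suc q + suc m))             ≤⟨ ℕ.m≤m+n _ (q ^ m * suc m) ⟩
    q * (q ^ m * (suc q + suc m)) + q ^ m * suc m  ≡⟨ expand q m (q ^ m) ⟩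
    suc q * (q ^ m * (suc q + m))             ≤⟨ ℕ.*-monoʳ-≤ (suc q) (pred-power-upper q m) ⟩
    suc q * suc q ^ suc m                     ∎
    where
    open ℕ.≤-Reasoning
    expand : ∀ q m p → q * (p * (suc q + suc m)) + p * suc m ≡ suc q * (p * (suc q + m))
    expand = solve-∀

  -- Bernoulli: (1 - 1/Z)^e ≥ 1 - e/Z for Z = 1 + q
  pred-power-lower : ∀ q e → suc q ^ suc e ≤ q ^ e * suc q + e * suc q ^ e
  pred-power-lower q zero    = ℕ.≤-reflexive (zero-case q)
    where
    zero-case : ∀ q → suc q * 1 ≡ 1 * suc q + 0
    zero-case = solve-∀
  pred-power-lower q (suc e) = begin
    suc q * suc q ^ suc e                                ≤⟨ ℕ.*-monoʳ-≤ (suc q) (pred-power-lower q e) ⟩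
    suc q * (q ^ e * suc q + e * suc q ^ e)              ≡⟨ expand q (q ^ e) e (suc q ^ e) ⟩
    q * q ^ e * suc q + (suc q * q ^ e + e * (suc q * suc q ^ e))
      ≤⟨ ℕ.+-monoʳ-≤ (q * q ^ e * suc q) (ℕ.+-monoˡ-≤ (e * (suc q * suc q ^ e)) (ℕ.*-monoʳ-≤ (suc q) (ℕ.^-monoˡ-≤ e (ℕ.n≤1+n q)))) ⟩
    q * q ^ e * suc q + (suc q * suc q ^ e + e * (suc q * suc q ^ e)) ∎
    where
    open ℕ.≤-Reasoning
    expand : ∀ q p e r → suc q * (p * suc q + e * r) ≡ q * p * suc q + (suc q * p + e * (suc q * r))
    expand = solve-∀

  -- Bernoulli: (1 + 1/Z)^m ≥ 1 + m/Z
  suc-power-lower : ∀ Z m → Z ^ m * (Z + m) ≤ Z * suc Z ^ m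
  suc-power-lower Z zero    = ℕ.≤-reflexive (zero-case Z)
    where
    zero-case : ∀ Z → 1 * (Z + 0) ≡ Z * 1
    zero-case = solve-∀
  suc-power-lower Z (suc m) = begin
    Z * Z ^ m * (Z + suc m)                  ≡⟨ expand Z (Z ^ m) m ⟩
    Z * (Z ^ m * (Z + m)) + Z * Z ^ m        ≤⟨ ℕ.+-mono-≤ (ℕ.*-monoʳ-≤ Z (suc-power-lower Z m)) (ℕ.*-monoʳ-≤ Z (ℕ.^-monoˡ-≤ m (ℕ.n≤1+n Z))) ⟩
    Z * (Z * suc Z ^ m) + Z * suc Z ^ m      ≡⟨ collect Z (suc Z ^ m) ⟩
    Z * (suc Z * suc Z ^ m)                  ∎
    where
    open ℕ.≤-Reasoning
    expand : ∀ Z p m → Z * p * (Z + suc m) ≡ Z * (p * (Z + m)) + Z * p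
    expand = solve-∀
    collect : ∀ Z s → Z * (Z * s) + Z * s ≡ Z * (suc Z * s)
    collect = solve-∀

  -- A = 2 d is the optimal inverse step size of the weights for a deviation of 1/d.
  module _ (d′ : ℕ) where
    private
      d = suc d′
      e = d * d′
      a = suc (2 * d′)
      A = suc a

    d+2e : d + (e + e) ≡ d * d + e
    d+2e = lemma d′
      where
      lemma : ∀ d′ → suc d′ + (suc d′ * d′ + suc d′ * d′) ≡ suc d′ * suc d′ + suc d′ * d′
      lemma = solve-∀

    d*d≡d+e : d * d ≡ d + e
    d*d≡d+e = lemma d′
      where
      lemma : ∀ d′ → suc d′ * suc d′ ≡ suc d′ + suc d′ * d′
      lemma = solve-∀

    -- (1 + 1/A)^d ≥ 1 + d/A = 3/2, since A = 2 d.
    up-power : 3 * A ^ d ≤ 2 * suc A ^ d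
    up-power = ℕ.*-cancelˡ-≤ d (begin
      d * (3 * A ^ d)        ≡⟨ left d′ (A ^ d) ⟩
      A ^ d * (A + d)        ≤⟨ suc-power-lower A d ⟩
      A * suc A ^ d          ≡⟨ right d′ (suc A ^ d) ⟩
      d * (2 * suc A ^ d)    ∎)
      where
      open ℕ.≤-Reasoning
      left : ∀ d′ p → suc d′ * (3 * p) ≡ p * (suc (suc (2 * d′)) + suc d′)
      left = solve-∀
      right : ∀ d′ p → suc (suc (2 * d′)) * p ≡ suc d′ * (2 * p)
      right = solve-∀

    -- (1 - 1/A²)^e ≥ 1 - e/A² ≥ 3/4, since `suc A * a` is A² - 1 and 4 e ≤ 4 d² = A².
    down-power : 3 * (A * A) ^ e ≤ 4 * (suc A * a) ^ e
    down-power = subst (λ Z → 3 * Z ^ e ≤ 4 * (suc A * a) ^ e) (square a) (ℕ.*-cancelˡ-≤ Z (ℕ.+-cancelʳ-≤ (Z * Z ^ e) _ _ (begin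
      Z * (3 * Z ^ e) + Z * Z ^ e                      ≡⟨ left Z (Z ^ e) ⟩
      4 * (Z * Z ^ e)                                  ≤⟨ ℕ.*-monoʳ-≤ 4 (pred-power-lower (suc A * a) e) ⟩
      4 * ((suc A * a) ^ e * Z + e * Z ^ e)            ≡⟨ middle Z ((suc A * a) ^ e) e (Z ^ e) ⟩
      Z * (4 * (suc A * a) ^ e) + 4 * e * Z ^ e        ≤⟨ ℕ.+-monoʳ-≤ (Z * (4 * (suc A * a) ^ e)) (ℕ.*-monoˡ-≤ (Z ^ e) 4e≤Z) ⟩
      Z * (4 * (suc A * a) ^ e) + Z * Z ^ e            ∎)))
      where
      open ℕ.≤-Reasoning
      Z = suc (suc A * a)
      square : ∀ a → suc (suc (suc a) * a) ≡ suc a * suc a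
      square = solve-∀
      left : ∀ Z p → Z * (3 * p) + Z * p ≡ 4 * (Z * p)
      left = solve-∀
      middle : ∀ Z r e p → 4 * (r * Z + e * p) ≡ Z * (4 * r) + 4 * e * p
      middle = solve-∀
      4e+ : ∀ d′ → suc (suc (suc (suc (2 * d′))) * suc (2 * d′)) ≡ 4 * (suc d′ * d′) + 4 * suc d′
      4e+ = solve-∀
      4e≤Z : 4 * e ≤ Z
      4e≤Z = ℕ.≤-trans (ℕ.m≤m+n (4 * e) (4 * d)) (ℕ.≤-reflexive (sym (4e+ d′)))

    -- Because d² = d + e, the product (1 + 1/A)^(d²) (1 - 1/A)^e equals (1 + 1/A)^d (1 - 1/A²)^e,
    -- which is at least 3/2 · 3/4 = 9/8.
    fraction-power : 9 * (A ^ (d * d) * A ^ e) ≤ 8 * (suc A ^ (d * d) * a ^ e)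
    fraction-power = begin
      9 * (A ^ (d * d) * A ^ e)                   ≡⟨ cong (9 *_) (ℕ.^-distribˡ-+-* A (d * d) e) ⟨
      9 * A ^ (d * d + e)                         ≡⟨ cong (λ m → 9 * A ^ m) d+2e ⟨
      9 * A ^ (d + (e + e))                       ≡⟨ cong (9 *_) (trans (ℕ.^-distribˡ-+-* A d (e + e))
                                                       (cong (A ^ d *_) (trans (ℕ.^-distribˡ-+-* A e e) (sym (^-distribʳ-* e A A))))) ⟩
      9 * (A ^ d * (A * A) ^ e)                   ≡⟨ left (A ^ d) _ ⟩
      3 * A ^ d * (3 * (A * A) ^ e)               ≤⟨ ℕ.*-mono-≤ up-power down-power ⟩
      2 * suc A ^ d * (4 * (suc A * a) ^ e)       ≡⟨ cong (λ z → 2 * suc A ^ d * (4 * z)) (^-distribʳ-* e (suc A) a) ⟩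
      2 * suc A ^ d * (4 * (suc A ^ e * a ^ e))   ≡⟨ right (suc A ^ d) _ _ ⟩
      8 * (suc A ^ d * suc A ^ e * a ^ e)         ≡⟨ cong (λ z → 8 * (z * a ^ e)) (ℕ.^-distribˡ-+-* (suc A) d e) ⟨
      8 * (suc A ^ (d + e) * a ^ e)               ≡⟨ cong (λ m → 8 * (suc A ^ m * a ^ e)) d*d≡d+e ⟨
      8 * (suc A ^ (d * d) * a ^ e)               ∎
      where
      open ℕ.≤-Reasoning
      left : ∀ x y → 9 * (x * y) ≡ 3 * x * (3 * y)
      left = solve-∀
      right : ∀ x y z → 2 * x * (4 * (y * z)) ≡ 8 * (x * y * z)
      right = solve-∀

    module _ (K : ℕ) .{{_ : NonZero K}} (q : ℕ) (KA≡1+q : K * A ≡ suc q) where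

      -- K rounds, in which one hit is expected, shrink the total by (1 - 1/(K A))^K ≤ 1/(1 + 1/A).
      -- This is `pred-power-upper` with Z = K A and m = K.
      round-factor : q ^ K * suc A ≤ A * (K * A) ^ K
      round-factor = ℕ.*-cancelˡ-≤ K (begin
        K * (q ^ K * suc A)          ≡⟨ left K A (q ^ K) ⟩
        q ^ K * (K * A + K)          ≡⟨ cong (λ z → q ^ K * (z + K)) KA≡1+q ⟩
        q ^ K * (suc q + K)          ≤⟨ pred-power-upper q K ⟩
        suc q ^ suc K                ≡⟨ cong (_^ suc K) KA≡1+q ⟨
        K * A * (K * A) ^ K          ≡⟨ ℕ.*-assoc K A _ ⟩
        K * (A * (K * A) ^ K)        ∎)
        where
        open ℕ.≤-Reasoning
        left : ∀ K A p → K * (p * suc A) ≡ p * (K * A + K)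
        left = solve-∀

      u : ℕ
      u = K * (d * d)

      rounds-factor : q ^ u * suc A ^ (d * d) ≤ A ^ (d * d) * (K * A) ^ u
      rounds-factor = begin
        q ^ u * suc A ^ (d * d)              ≡⟨ cong (_* suc A ^ (d * d)) (ℕ.^-*-assoc q K (d * d)) ⟨
        (q ^ K) ^ (d * d) * suc A ^ (d * d)  ≡⟨ ^-distribʳ-* (d * d) (q ^ K) (suc A) ⟨
        (q ^ K * suc A) ^ (d * d)            ≤⟨ ℕ.^-monoˡ-≤ (d * d) round-factor ⟩
        (A * (K * A) ^ K) ^ (d * d)          ≡⟨ ^-distribʳ-* (d * d) A ((K * A) ^ K) ⟩
        A ^ (d * d) * ((K * A) ^ K) ^ (d * d) ≡⟨ cong (A ^ (d * d) *_) (ℕ.^-*-assoc (K * A) K (d * d)) ⟩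
        A ^ (d * d) * (K * A) ^ u            ∎
        where open ℕ.≤-Reasoning

      -- In a block of u = K d² rounds d² hits are expected and e = d² - d are demanded. The block
      -- shrinks the total to at most 8/9 of the factor (1 - 1/A)^e that these e hits contribute to
      -- a single weight.
      eight-ninths : 9 * (q ^ u * A ^ e) ≤ 8 * ((K * A) ^ u * a ^ e)
      eight-ninths = ℕ.*-cancelˡ-≤ (suc A ^ (d * d) * A ^ (d * d)) (begin
        suc A ^ (d * d) * A ^ (d * d) * (9 * (q ^ u * A ^ e))   ≡⟨ left (suc A ^ (d * d)) (A ^ (d * d)) (q ^ u) (A ^ e) ⟩
        q ^ u * suc A ^ (d * d) * (9 * (A ^ (d * d) * A ^ e))   ≤⟨ ℕ.*-mono-≤ rounds-factor fraction-power ⟩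
        A ^ (d * d) * (K * A) ^ u * (8 * (suc A ^ (d * d) * a ^ e))
                                                               ≡⟨ right (suc A ^ (d * d)) (A ^ (d * d)) ((K * A) ^ u) (a ^ e) ⟩
        suc A ^ (d * d) * A ^ (d * d) * (8 * ((K * A) ^ u * a ^ e)) ∎)
        where
        open ℕ.≤-Reasoning
        instance
          s≢0 : NonZero (suc A ^ (d * d))
          s≢0 = ℕ.m^n≢0 (suc A) (d * d)
          t≢0 : NonZero (A ^ (d * d))
          t≢0 = ℕ.m^n≢0 A (d * d)
          st≢0 : NonZero (suc A ^ (d * d) * A ^ (d * d))
          st≢0 = ℕ.m*n≢0 (suc A ^ (d * d)) (A ^ (d * d))
        left : ∀ s t x y → s * t * (9 * (x * y)) ≡ x * s * (9 * (t * y))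
        left = solve-∀
        right : ∀ s t x y → t * x * (8 * (s * y)) ≡ s * t * (8 * (x * y))
        right = solve-∀

      -- (8/9)^6 < 1/2
      one-half : 2 * (q ^ u * A ^ e) ^ 6 ≤ ((K * A) ^ u * a ^ e) ^ 6
      one-half = sixth (q ^ u * A ^ e) ((K * A) ^ u * a ^ e) eight-ninths
        where
        open ℕ.≤-Reasoning
        arrange : ∀ c x → c * (2 * x) ≡ 2 * c * x
        arrange = solve-∀
        sixth : ∀ x y → 9 * x ≤ 8 * y → 2 * x ^ 6 ≤ y ^ 6
        sixth x y le = ℕ.*-cancelˡ-≤ (8 ^ 6) (begin
          8 ^ 6 * (2 * x ^ 6)   ≡⟨ arrange (8 ^ 6) (x ^ 6) ⟩
          2 * 8 ^ 6 * x ^ 6     ≤⟨ ℕ.*-monoˡ-≤ (x ^ 6) (toWitness {a? = 2 * 8 ^ 6 ℕ.≤? 9 ^ 6} _) ⟩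
          9 ^ 6 * x ^ 6         ≡⟨ ^-distribʳ-* 6 9 x ⟨
          (9 * x) ^ 6           ≤⟨ ℕ.^-monoˡ-≤ 6 le ⟩
          (8 * y) ^ 6           ≡⟨ ^-distribʳ-* 6 8 y ⟩
          8 ^ 6 * y ^ 6         ∎)

      potential-vanishes : ∀ m → 2 ^ m * (q ^ (u * (6 * m)) * A ^ (e * (6 * m))) ≤ (K * A) ^ (u * (6 * m)) * a ^ (e * (6 * m))
      potential-vanishes m = begin
        2 ^ m * (q ^ (u * (6 * m)) * A ^ (e * (6 * m)))   ≡⟨ cong (2 ^ m *_) (pull q A) ⟨
        2 ^ m * ((q ^ u * A ^ e) ^ 6) ^ m                 ≡⟨ ^-distribʳ-* m 2 _ ⟨
        (2 * (q ^ u * A ^ e) ^ 6) ^ m                     ≤⟨ ℕ.^-monoˡ-≤ m one-half ⟩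
        (((K * A) ^ u * a ^ e) ^ 6) ^ m                   ≡⟨ pull (K * A) a ⟩
        (K * A) ^ (u * (6 * m)) * a ^ (e * (6 * m))       ∎
        where
        open ℕ.≤-Reasoning
        pull : ∀ x y → ((x ^ u * y ^ e) ^ 6) ^ m ≡ x ^ (u * (6 * m)) * y ^ (e * (6 * m))
        pull x y = trans (ℕ.^-*-assoc (x ^ u * y ^ e) 6 m) (trans (^-distribʳ-* (6 * m) (x ^ u) (y ^ e))
          (cong₂ _*_ (ℕ.^-*-assoc x u (6 * m)) (ℕ.^-*-assoc y e (6 * m))))

  -- The number of orders, with g in the role of log₂ n; 6 is the least m with 2 (8/9)^m ≤ 1.
  support : ℕ → ℕ → ℕ → ℕ
  support k d g = k ! * (d * d) * (6 * (k * g))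

  -- Every injective tuple is hit at least (1 - 1/d) ξ / k! times, with d = d′ + 1 and ξ the number
  -- of orders. Each six blocks halve the potential, and k g halvings absorb the at most 2^(k g)
  -- tuples.
  uniform-orders : ∀ k d′ g n → n ≤ 2 ^ g → Σ (ℕ → Permutation′ n) λ P →
    ∀ (y : Fin k → Fin n) → Injective _≡_ _≡_ y →
    d′ * support k (suc d′) g ≤ k ! * suc d′ * hits (Ordered y ∘ P) (support k (suc d′) g)
  uniform-orders k d′ g n n≤2^g = choice , enough
    where
    d = suc d′
    e = d * d′
    a = suc (2 * d′)
    m = k * g
    instance
      k!≢0 : NonZero (k !)
      k!≢0 = k ℕ.!≢0
      KA≢0 : NonZero (k ! * suc a)
      KA≢0 = ℕ.m*n≢0 (k !) (suc a)
    q = ℕ.pred (k ! * suc a)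
    KA≡1+q : k ! * suc a ≡ suc q
    KA≡1+q = sym (ℕ.suc-pred (k ! * suc a))
    open MultiplicativeWeights (permutations n) (subst (0 <_) (sym (length-permutations n)) (ℕ.>-nonZero⁻¹ (n !) {{n ℕ.!≢0}}))
      (vectors k n) (λ v → Ordered (lookup v)) (k !) a q KA≡1+q
    ξ = support k d g
    -- T = (1 - 1/d) ξ / k!, because ξ consists of 6 m blocks of k! d² rounds.
    T = e * (6 * m)

    frequent : ∀ v → Injective _≡_ _≡_ (lookup v) → Frequent v
    frequent v inj = subst (_≤ k ! * frequency v) (sym (length-permutations n)) (ordered-frequency n k (lookup v) inj)

    vectors≤ : length (vectors k n) ≤ 2 ^ m
    vectors≤ = begin
      length (vectors k n)           ≡⟨ ℕ.*-identityʳ _ ⟨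
      length (vectors k n) * 1       ≡⟨ ∑-const (vectors k n) 1 ⟨
      ∑ (vectors k n) (λ _ → 1)      ≡⟨ ∑-vectors k n ⟩
      n ^ k                          ≤⟨ ℕ.^-monoˡ-≤ k n≤2^g ⟩
      (2 ^ g) ^ k                    ≡⟨ ℕ.^-*-assoc 2 g k ⟩
      2 ^ (g * k)                    ≡⟨ cong (2 ^_) (ℕ.*-comm g k) ⟩
      2 ^ m                          ∎
      where open ℕ.≤-Reasoning

    small-potential : q ^ ξ * length (vectors k n) * suc a ^ T ≤ (k ! * suc a) ^ ξ * a ^ T
    small-potential = begin
      q ^ ξ * length (vectors k n) * suc a ^ T   ≤⟨ ℕ.*-monoˡ-≤ (suc a ^ T) (ℕ.*-monoʳ-≤ (q ^ ξ) vectors≤) ⟩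
      q ^ ξ * 2 ^ m * suc a ^ T                  ≡⟨ rearrange (q ^ ξ) (2 ^ m) _ ⟩
      2 ^ m * (q ^ ξ * suc a ^ T)                ≤⟨ potential-vanishes d′ (k !) q KA≡1+q m ⟩
      (k ! * suc a) ^ ξ * a ^ T                  ∎
      where
      open ℕ.≤-Reasoning
      rearrange : ∀ x y z → x * y * z ≡ y * (x * z)
      rearrange = solve-∀

    enough : ∀ (y : Fin k → Fin n) → Injective _≡_ _≡_ y → d′ * ξ ≤ k ! * d * hits (Ordered y ∘ choice) ξ
    enough y inj = begin
      d′ * ξ                              ≡⟨ rearrange d′ (k !) (6 * m) ⟩
      k ! * d * T                         ≤⟨ ℕ.*-monoʳ-≤ (k ! * d) (count≥ (∈-vectors v) (frequent v v-inj) ξ T small-potential) ⟩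
      k ! * d * count ξ v                 ≤⟨ ℕ.*-monoʳ-≤ (k ! * d) (hits-mono ξ) ⟩
      k ! * d * hits (Ordered y ∘ choice) ξ  ∎
      where
      open ℕ.≤-Reasoning
      v = tabulate y
      v-inj : Injective _≡_ _≡_ (lookup v)
      v-inj {i} {j} eq = inj (trans (sym (lookup∘tabulate y i)) (trans eq (lookup∘tabulate y j)))
      hits-mono : ∀ t → count t v ≤ hits (Ordered y ∘ choice) t
      hits-mono zero    = z≤n
      hits-mono (suc t) = ℕ.+-mono-≤ (𝟙-mono (Ordered-cong (choice t) (lookup∘tabulate y))) (hits-mono t)
      rearrange : ∀ d′ K s → d′ * (K * (suc d′ * suc d′) * s) ≡ K * suc d′ * (suc d′ * d′ * s)
      rearrange = solve-∀

open Orders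
open import Data.Rational.Base as ℚ using (ℚ; mkℚ; 0ℚ; 1ℚ; ½; _+_; _*_; _-_; _≤_; _<_; toℚᵘ)

-- Rationals

toℚᵘ-ℕtoℚ : ∀ n → toℚᵘ (ℕtoℚ n) ℚᵘ.≃ mkℚᵘ (pos n) 0
toℚᵘ-ℕtoℚ n = ℚ.toℚᵘ-fromℚᵘ (mkℚᵘ (pos n) 0)

ℕtoℚ-+ : ∀ m n → ℕtoℚ (m ℕ.+ n) ≡ ℕtoℚ m + ℕtoℚ n
ℕtoℚ-+ m n = ℚ.toℚᵘ-injective (begin-equality
  toℚᵘ (ℕtoℚ (m ℕ.+ n))                  ≃⟨ toℚᵘ-ℕtoℚ (m ℕ.+ n) ⟩
  mkℚᵘ (pos (m ℕ.+ n)) 0                   ≃⟨ *≡* (cong (ℤ._* pos 1) (cong₂ ℤ._+_ (ℤ.*-identityʳ (pos m)) (ℤ.*-identityʳ (pos n)))) ⟨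
  mkℚᵘ (pos m) 0 ℚᵘ.+ mkℚᵘ (pos n) 0         ≃⟨ ℚᵘ.+-cong (toℚᵘ-ℕtoℚ m) (toℚᵘ-ℕtoℚ n) ⟨
  toℚᵘ (ℕtoℚ m) ℚᵘ.+ toℚᵘ (ℕtoℚ n)       ≃⟨ ℚ.toℚᵘ-homo-+ (ℕtoℚ m) (ℕtoℚ n) ⟨
  toℚᵘ (ℕtoℚ m + ℕtoℚ n)                 ∎)
  where open ℚᵘ.≤-Reasoning

ℕtoℚ-* : ∀ m n → ℕtoℚ (m ℕ.* n) ≡ ℕtoℚ m * ℕtoℚ n
ℕtoℚ-* m n = ℚ.toℚᵘ-injective (begin-equality
  toℚᵘ (ℕtoℚ (m ℕ.* n))                  ≃⟨ toℚᵘ-ℕtoℚ (m ℕ.* n) ⟩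
  mkℚᵘ (pos (m ℕ.* n)) 0                   ≃⟨ *≡* (cong (ℤ._* pos 1) (ℤ.pos-* m n)) ⟩
  mkℚᵘ (pos m) 0 ℚᵘ.* mkℚᵘ (pos n) 0         ≃⟨ ℚᵘ.*-cong (toℚᵘ-ℕtoℚ m) (toℚᵘ-ℕtoℚ n) ⟨
  toℚᵘ (ℕtoℚ m) ℚᵘ.* toℚᵘ (ℕtoℚ n)       ≃⟨ ℚ.toℚᵘ-homo-* (ℕtoℚ m) (ℕtoℚ n) ⟨
  toℚᵘ (ℕtoℚ m * ℕtoℚ n)                 ∎)
  where open ℚᵘ.≤-Reasoning

ℕtoℚ-mono-≤ : ∀ {m n} → m ℕ.≤ n → ℕtoℚ m ≤ ℕtoℚ n
ℕtoℚ-mono-≤ {m} {n} m≤n = ℚ.toℚᵘ-cancel-≤ (begin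
  toℚᵘ (ℕtoℚ m)   ≃⟨ toℚᵘ-ℕtoℚ m ⟩
  mkℚᵘ (pos m) 0    ≤⟨ *≤* (ℤ.*-monoʳ-≤-nonNeg (pos 1) (ℤ.+≤+ m≤n)) ⟩
  mkℚᵘ (pos n) 0    ≃⟨ toℚᵘ-ℕtoℚ n ⟨
  toℚᵘ (ℕtoℚ n)   ∎)
  where open ℚᵘ.≤-Reasoning

ℕtoℚ-cancel-≤ : ∀ {m n} → ℕtoℚ m ≤ ℕtoℚ n → m ℕ.≤ n
ℕtoℚ-cancel-≤ {m} {n} le = ℤ.drop‿+≤+ (ℤ.*-cancelʳ-≤-pos (pos m) (pos n) (pos 1) (ℚᵘ.drop-*≤* (begin
  mkℚᵘ (pos m) 0    ≃⟨ toℚᵘ-ℕtoℚ m ⟨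
  toℚᵘ (ℕtoℚ m)   ≤⟨ ℚ.toℚᵘ-mono-≤ le ⟩
  toℚᵘ (ℕtoℚ n)   ≃⟨ toℚᵘ-ℕtoℚ n ⟩
  mkℚᵘ (pos n) 0    ∎)))
  where open ℚᵘ.≤-Reasoning

0≤ℕtoℚ : ∀ n → 0ℚ ≤ ℕtoℚ n
0≤ℕtoℚ n = ℕtoℚ-mono-≤ {0} {n} z≤n

0<ℕtoℚ : ∀ {n} → 0 ℕ.< n → 0ℚ < ℕtoℚ n
0<ℕtoℚ {n} 0<n with 0ℚ ℚ.<? ℕtoℚ n
... | yes p = p
... | no ¬p = contradiction (ℕtoℚ-cancel-≤ {n} {0} (ℚ.≮⇒≥ ¬p)) (ℕ.<⇒≱ 0<n)

*-mono-≤ : ∀ {p q r s} → 0ℚ ≤ p → 0ℚ ≤ r → p ≤ q → r ≤ s → p * r ≤ q * s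
*-mono-≤ {p} {q} {r} {s} 0≤p 0≤r p≤q r≤s = ℚ.≤-trans
  (ℚ.*-monoʳ-≤-nonNeg r {{ℚ.nonNegative 0≤r}} p≤q)
  (ℚ.*-monoˡ-≤-nonNeg q {{ℚ.nonNegative (ℚ.≤-trans 0≤p p≤q)}} r≤s)

*-nonNeg : ∀ {p q} → 0ℚ ≤ p → 0ℚ ≤ q → 0ℚ ≤ p * q
*-nonNeg {p} {q} 0≤p 0≤q = subst (_≤ p * q) (ℚ.*-zeroˡ q) (ℚ.*-monoʳ-≤-nonNeg q {{ℚ.nonNegative 0≤q}} 0≤p)

+-nonNeg : ∀ {p q} → 0ℚ ≤ p → 0ℚ ≤ q → 0ℚ ≤ p + q
+-nonNeg 0≤p 0≤q = ℚ.+-mono-≤ 0≤p 0≤q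

*-pos : ∀ {p q} → 0ℚ < p → 0ℚ < q → 0ℚ < p * q
*-pos {p} {q} 0<p 0<q = subst (_< p * q) (ℚ.*-zeroˡ q) (ℚ.*-monoˡ-<-pos q {{ℚ.positive 0<q}} 0<p)

*-inv : ∀ {q} → 0ℚ < q → q * inv q ≡ 1ℚ
*-inv {q} 0<q with q ℚ.≟ 0ℚ
... | yes q≡0 = contradiction (sym q≡0) (ℚ.<⇒≢ 0<q)
... | no  q≢0 = ℚ.*-inverseʳ q {{ℚ.≢-nonZero q≢0}}

0<inv : ∀ {q} → 0ℚ < q → 0ℚ < inv q
0<inv {q} 0<q with q ℚ.≟ 0ℚ
... | yes q≡0 = contradiction (sym q≡0) (ℚ.<⇒≢ 0<q)
... | no  q≢0 = ℚ.positive⁻¹ _ {{ℚ.1/pos⇒pos q {{ℚ.positive 0<q}}}}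

0≤inv : ∀ {q} → 0ℚ < q → 0ℚ ≤ inv q
0≤inv = ℚ.<⇒≤ ∘ 0<inv

*inv-≤ : ∀ {x z q} → 0ℚ < z → x ≤ q * z → x * inv z ≤ q
*inv-≤ {x} {z} {q} 0<z le = begin
  x * inv z         ≤⟨ ℚ.*-monoʳ-≤-nonNeg (inv z) {{ℚ.nonNegative (0≤inv 0<z)}} le ⟩
  q * z * inv z     ≡⟨ ℚ.*-assoc q z (inv z) ⟩
  q * (z * inv z)   ≡⟨ cong (q *_) (*-inv 0<z) ⟩
  q * 1ℚ            ≡⟨ ℚ.*-identityʳ q ⟩
  q                 ∎
  where open ℚ.≤-Reasoning

≤-*inv : ∀ {x z q} → 0ℚ < z → q * z ≤ x → q ≤ x * inv z
≤-*inv {x} {z} {q} 0<z le = begin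
  q                 ≡⟨ ℚ.*-identityʳ q ⟨
  q * 1ℚ            ≡⟨ cong (q *_) (*-inv 0<z) ⟨
  q * (z * inv z)   ≡⟨ ℚ.*-assoc q z (inv z) ⟨
  q * z * inv z     ≤⟨ ℚ.*-monoʳ-≤-nonNeg (inv z) {{ℚ.nonNegative (0≤inv 0<z)}} le ⟩
  x * inv z         ∎
  where open ℚ.≤-Reasoning

sumℚ-mono : ∀ {A : Set} (xs : List A) {f g} → (∀ x → f x ≤ g x) → sumℚ (map f xs) ≤ sumℚ (map g xs)
sumℚ-mono []       f≤g = ℚ.≤-refl
sumℚ-mono (x ∷ xs) f≤g = ℚ.+-mono-≤ (f≤g x) (sumℚ-mono xs f≤g)

sumℚ-nonNeg : ∀ {A : Set} (xs : List A) {f} → (∀ x → 0ℚ ≤ f x) → 0ℚ ≤ sumℚ (map f xs)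
sumℚ-nonNeg []       0≤f = ℚ.≤-refl
sumℚ-nonNeg (x ∷ xs) 0≤f = +-nonNeg (0≤f x) (sumℚ-nonNeg xs 0≤f)

sumℚ-*ʳ : ∀ {A : Set} (xs : List A) f c → sumℚ (map (λ x → f x * c) xs) ≡ sumℚ (map f xs) * c
sumℚ-*ʳ []       f c = sym (ℚ.*-zeroˡ c)
sumℚ-*ʳ (x ∷ xs) f c = trans (cong ((f x * c) +_) (sumℚ-*ʳ xs f c)) (sym (ℚ.*-distribʳ-+ c (f x) _))

sumℚ-ℕtoℚ : ∀ {A : Set} (xs : List A) {f g} → (∀ x → f x ≡ ℕtoℚ (g x)) → sumℚ (map f xs) ≡ ℕtoℚ (∑ xs g)
sumℚ-ℕtoℚ []       eq = refl
sumℚ-ℕtoℚ (x ∷ xs) {g = g} eq = trans (cong₂ _+_ (eq x) (sumℚ-ℕtoℚ xs eq)) (sym (ℕtoℚ-+ (g x) (∑ xs g)))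

-- Total mass of the binomial distribution

∑-upTo-suc : ∀ m f → ∑ (upTo (suc m)) f ≡ f 0 ℕ.+ ∑ (upTo m) (f ∘ suc)
∑-upTo-suc m f = cong (λ xs → f 0 ℕ.+ sum xs)
  (trans (map-applyUpTo suc f m) (sym (map-upTo (f ∘ suc) m)))

-- Allowing every cutoff `m` lets Pascal's rule close the induction without a separate treatment of
-- the boundary term.
∑-C≤2^ : ∀ n m → ∑ (upTo m) (n C_) ℕ.≤ 2 ℕ.^ n
∑-C≤2^ n       zero    = z≤n
∑-C≤2^ zero    (suc m) = ℕ.≤-reflexive (begin
  ∑ (upTo (suc m)) (0 C_)           ≡⟨ ∑-upTo-suc m (0 C_) ⟩
  1 ℕ.+ ∑ (upTo m) (λ _ → 0)        ≡⟨ cong suc (trans (∑-const (upTo m) 0) (ℕ.*-zeroʳ (length (upTo m)))) ⟩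
  1                                 ∎)
  where
  open ≡-Reasoning
∑-C≤2^ (suc n) (suc m) = begin
  ∑ (upTo (suc m)) (suc n C_)
    ≡⟨ ∑-upTo-suc m (suc n C_) ⟩
  1 ℕ.+ ∑ (upTo m) (λ t → suc n C suc t)
    ≡⟨ cong suc (∑-cong (upTo m) (λ t → sym (nCk+nC[k+1]≡[n+1]C[k+1] n t))) ⟩
  1 ℕ.+ ∑ (upTo m) (λ t → n C t ℕ.+ n C suc t)
    ≡⟨ cong suc (trans (∑-+ (upTo m) (n C_) (λ t → n C suc t)) (ℕ.+-comm (∑ (upTo m) (n C_)) _)) ⟩
  1 ℕ.+ ∑ (upTo m) (λ t → n C suc t) ℕ.+ ∑ (upTo m) (n C_)
    ≡⟨ cong (ℕ._+ ∑ (upTo m) (n C_)) (∑-upTo-suc m (n C_)) ⟨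
  ∑ (upTo (suc m)) (n C_) ℕ.+ ∑ (upTo m) (n C_)
    ≤⟨ ℕ.+-mono-≤ (∑-C≤2^ n (suc m)) (∑-C≤2^ n m) ⟩
  2 ℕ.^ n ℕ.+ 2 ℕ.^ n
    ≡⟨ cong (2 ℕ.^ n ℕ.+_) (ℕ.+-identityʳ _) ⟨
  2 ℕ.^ suc n ∎
  where open ℕ.≤-Reasoning

0≤binomProb : ∀ n t → 0ℚ ≤ binomProb n t
0≤binomProb n t = *-nonNeg (0≤ℕtoℚ (n C t)) (0≤inv (0<ℕtoℚ (ℕ.m^n>0 2 n)))

∑-binomProb≤1 : ∀ n m → sumℚ (map (binomProb n) (upTo m)) ≤ 1ℚ
∑-binomProb≤1 n m = subst (_≤ 1ℚ) (sym (trans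
    (sumℚ-*ʳ (upTo m) (λ t → ℕtoℚ (n C t)) (inv (ℕtoℚ (2 ℕ.^ n))))
    (cong (_* inv (ℕtoℚ (2 ℕ.^ n))) (sumℚ-ℕtoℚ (upTo m) {g = n C_} (λ _ → refl)))))
  (*inv-≤ (0<ℕtoℚ (ℕ.m^n>0 2 n))
    (subst (ℕtoℚ (∑ (upTo m) (n C_)) ≤_) (sym (ℚ.*-identityˡ _)) (ℕtoℚ-mono-≤ (∑-C≤2^ n m))))

ℚ-ring : AlmostCommutativeRing 0ℓ 0ℓ
ℚ-ring = fromCommutativeRing ℚ.+-*-commutativeRing (λ _ → nothing)

sumℚ-+ : ∀ {A : Set} (xs : List A) f g → sumℚ (map (λ x → f x + g x) xs) ≡ sumℚ (map f xs) + sumℚ (map g xs)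
sumℚ-+ []       f g = refl
sumℚ-+ (x ∷ xs) f g = trans (cong ((f x + g x) +_) (sumℚ-+ xs f g)) (interchange (f x) (g x) _ _)
  where
  interchange : ∀ a b c d → (a + b) + (c + d) ≡ (a + c) + (b + d)
  interchange = solveRing-∀ ℚ-ring

-- Partial sums of the exponential series

powℚ-nonNeg : ∀ {y} j → 0ℚ ≤ y → 0ℚ ≤ powℚ y j
powℚ-nonNeg zero    0≤y = 0≤ℕtoℚ 1
powℚ-nonNeg (suc j) 0≤y = *-nonNeg 0≤y (powℚ-nonNeg j 0≤y)

powℚ-mono : ∀ {y z} j → 0ℚ ≤ y → y ≤ z → powℚ y j ≤ powℚ z j
powℚ-mono zero    0≤y y≤z = ℚ.≤-refl
powℚ-mono (suc j) 0≤y y≤z = *-mono-≤ 0≤y (powℚ-nonNeg j 0≤y) y≤z (powℚ-mono j 0≤y y≤z)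

expTerm : ℚ → ℕ → ℚ
expTerm y j = powℚ y j * inv (ℕtoℚ (j !))

0<j! : ∀ j → 0ℚ < ℕtoℚ (j !)
0<j! j = 0<ℕtoℚ (ℕ.>-nonZero⁻¹ (j !) {{j ℕ.!≢0}})

0≤inv! : ∀ j → 0ℚ ≤ inv (ℕtoℚ (j !))
0≤inv! j = 0≤inv (0<j! j)

inv-cancel : ∀ {a b} → 0ℚ < a → 0ℚ < b → a * inv (a * b) ≡ inv b
inv-cancel {a} {b} 0<a 0<b = begin
  a * inv (a * b)                     ≡⟨ ℚ.*-identityʳ _ ⟨
  a * inv (a * b) * 1ℚ                ≡⟨ cong (a * inv (a * b) *_) (*-inv 0<b) ⟨
  a * inv (a * b) * (b * inv b)       ≡⟨ regroup a b (inv (a * b)) (inv b) ⟩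
  a * b * inv (a * b) * inv b         ≡⟨ cong (_* inv b) (*-inv (*-pos 0<a 0<b)) ⟩
  1ℚ * inv b                          ≡⟨ ℚ.*-identityˡ _ ⟩
  inv b                               ∎
  where
  open ≡-Reasoning
  regroup : ∀ a b c d → a * c * (b * d) ≡ a * b * c * d
  regroup = solveRing-∀ ℚ-ring

-- The mean value estimate for a power, with the derivative taken at the right end, where it is
-- largest.
powℚ-increment : ∀ {y s} j → 0ℚ ≤ y → 0ℚ ≤ s →
  powℚ (y + s) (suc j) ≤ powℚ y (suc j) + ℕtoℚ (suc j) * (s * powℚ (y + s) j)
powℚ-increment {y} {s} zero    0≤y 0≤s = ℚ.≤-reflexive (lemma y s)
  where
  lemma : ∀ y s → (y + s) * 1ℚ ≡ y * 1ℚ + 1ℚ * (s * 1ℚ)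
  lemma y s = trans (ℚ.*-identityʳ (y + s)) (sym (cong₂ _+_ (ℚ.*-identityʳ y)
    (trans (ℚ.*-identityˡ (s * 1ℚ)) (ℚ.*-identityʳ s))))
powℚ-increment {y} {s} (suc j) 0≤y 0≤s = begin
  (y + s) * p                                            ≡⟨ ℚ.*-distribʳ-+ p y s ⟩
  y * p + s * p                                          ≤⟨ ℚ.+-monoˡ-≤ (s * p) (ℚ.*-monoˡ-≤-nonNeg y {{ℚ.nonNegative 0≤y}} (powℚ-increment j 0≤y 0≤s)) ⟩
  y * (powℚ y (suc j) + c * (s * p′)) + s * p            ≡⟨ regroup y (powℚ y (suc j)) c s p′ p ⟩
  y * powℚ y (suc j) + (c * s * (y * p′) + s * p)        ≤⟨ ℚ.+-monoʳ-≤ (y * powℚ y (suc j)) (ℚ.+-monoˡ-≤ (s * p)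
                                                              (ℚ.*-monoˡ-≤-nonNeg (c * s) {{ℚ.nonNegative (*-nonNeg (0≤ℕtoℚ (suc j)) 0≤s)}} y*p′≤p)) ⟩
  y * powℚ y (suc j) + (c * s * p + s * p)               ≡⟨ cong (y * powℚ y (suc j) +_) (collect c s p) ⟩
  y * powℚ y (suc j) + (1ℚ + c) * (s * p)                ≡⟨ cong (λ z → y * powℚ y (suc j) + z * (s * p)) (ℕtoℚ-+ 1 (suc j)) ⟨
  y * powℚ y (suc j) + ℕtoℚ (suc (suc j)) * (s * p)      ∎
  where
  open ℚ.≤-Reasoning
  c = ℕtoℚ (suc j)
  p′ = powℚ (y + s) j
  p = powℚ (y + s) (suc j)
  0≤p′ : 0ℚ ≤ p′
  0≤p′ = powℚ-nonNeg j (+-nonNeg 0≤y 0≤s)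
  y*p′≤p : y * p′ ≤ p
  y*p′≤p = ℚ.*-monoʳ-≤-nonNeg p′ {{ℚ.nonNegative 0≤p′}} (subst (_≤ y + s) (ℚ.+-identityʳ y) (ℚ.+-monoʳ-≤ y 0≤s))
  regroup : ∀ y a c s b p → y * (a + c * (s * b)) + s * p ≡ y * a + (c * s * (y * b) + s * p)
  regroup = solveRing-∀ ℚ-ring
  collect : ∀ c s p → c * s * p + s * p ≡ (1ℚ + c) * (s * p)
  collect c s p = trans (cong₂ _+_ (ℚ.*-assoc c s p) (sym (ℚ.*-identityˡ (s * p))))
    (trans (ℚ.+-comm (c * (s * p)) (1ℚ * (s * p))) (sym (ℚ.*-distribʳ-+ (s * p) 1ℚ c)))

-- Division by (j + 1)! turns the derivative of a term into the preceding term: the exponential is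
-- its own derivative.
expTerm-increment : ∀ {y s} j → 0ℚ ≤ y → 0ℚ ≤ s →
  expTerm (y + s) (suc j) ≤ expTerm y (suc j) + expTerm (y + s) j * s
expTerm-increment {y} {s} j 0≤y 0≤s = begin
  powℚ (y + s) (suc j) * i                          ≤⟨ ℚ.*-monoʳ-≤-nonNeg i {{ℚ.nonNegative (0≤inv! (suc j))}} (powℚ-increment j 0≤y 0≤s) ⟩
  (powℚ y (suc j) + c * (s * p)) * i                ≡⟨ regroup (powℚ y (suc j)) c s p i ⟩
  powℚ y (suc j) * i + p * (c * i) * s              ≡⟨ cong (λ z → powℚ y (suc j) * i + p * z * s) c*i ⟩
  powℚ y (suc j) * i + p * inv (ℕtoℚ (j !)) * s     ∎
  where
  open ℚ.≤-Reasoning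
  i = inv (ℕtoℚ (suc j !))
  c = ℕtoℚ (suc j)
  p = powℚ (y + s) j
  c*i : c * i ≡ inv (ℕtoℚ (j !))
  c*i = trans (cong (λ z → c * inv z) (ℕtoℚ-* (suc j) (j !))) (inv-cancel (0<ℕtoℚ {suc j} (s≤s z≤n)) (0<j! j))
  regroup : ∀ a c s p i → (a + c * (s * p)) * i ≡ a * i + p * (c * i) * s
  regroup = solveRing-∀ ℚ-ring

expPartial-suc : ∀ y m → expPartial y (suc m) ≡ 1ℚ + sumℚ (map (expTerm y ∘ suc) (upTo m))
expPartial-suc y m = cong (λ xs → 1ℚ + sumℚ xs) (trans (map-applyUpTo suc (expTerm y) m) (sym (map-upTo (expTerm y ∘ suc) m)))

-- A discrete form of e^{y+1/2} - e^y ≤ e^{y+1/2} / 2.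
expPartial-+½ : ∀ {y B} → 0ℚ ≤ y → 0ℚ ≤ B → (∀ m → expPartial y m ≤ B) → ∀ m → expPartial (y + ½) m ≤ B + B
expPartial-+½ 0≤y 0≤B bound zero = +-nonNeg 0≤B 0≤B
expPartial-+½ {y} {B} 0≤y 0≤B bound (suc m) = begin
  expPartial (y + ½) (suc m)
    ≡⟨ expPartial-suc (y + ½) m ⟩
  1ℚ + sumℚ (map (expTerm (y + ½) ∘ suc) (upTo m))
    ≤⟨ ℚ.+-monoʳ-≤ 1ℚ (sumℚ-mono (upTo m) (λ j → expTerm-increment j 0≤y 0≤½)) ⟩
  1ℚ + sumℚ (map (λ j → expTerm y (suc j) + expTerm (y + ½) j * ½) (upTo m))
    ≡⟨ cong (1ℚ +_) (trans (sumℚ-+ (upTo m) (expTerm y ∘ suc) _)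
         (cong (sumℚ (map (expTerm y ∘ suc) (upTo m)) +_) (sumℚ-*ʳ (upTo m) (expTerm (y + ½)) ½))) ⟩
  1ℚ + (sumℚ (map (expTerm y ∘ suc) (upTo m)) + expPartial (y + ½) m * ½)
    ≡⟨ trans (sym (ℚ.+-assoc 1ℚ (sumℚ (map (expTerm y ∘ suc) (upTo m))) (expPartial (y + ½) m * ½))) (cong (_+ expPartial (y + ½) m * ½) (sym (expPartial-suc y m))) ⟩
  expPartial y (suc m) + expPartial (y + ½) m * ½
    ≤⟨ ℚ.+-mono-≤ (bound (suc m)) (ℚ.*-monoʳ-≤-nonNeg ½ (expPartial-+½ 0≤y 0≤B bound m)) ⟩
  -- 2 B is the fixed point of x ↦ B + x/2, so the bound reproduces itself from `m` to `suc m`.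
  B + (B + B) * ½
    ≡⟨ cong (B +_) (trans (ℚ.*-distribʳ-+ ½ B B) (trans (sym (ℚ.*-distribˡ-+ B ½ ½)) (ℚ.*-identityʳ B))) ⟩
  B + B ∎
  where
  open ℚ.≤-Reasoning
  0≤½ : 0ℚ ≤ ½
  0≤½ = ℚ.nonNegative⁻¹ ½

expPartial-0 : ∀ m → expPartial 0ℚ m ≤ 1ℚ
expPartial-0 zero    = 0≤ℕtoℚ 1
expPartial-0 (suc m) = ℚ.≤-reflexive (trans (expPartial-suc 0ℚ m)
  (trans (cong (1ℚ +_) (sumℚ-ℕtoℚ (upTo m) {g = λ _ → 0} vanish))
    (cong (λ z → 1ℚ + ℕtoℚ z) (trans (∑-const (upTo m) 0) (ℕ.*-zeroʳ (length (upTo m)))))))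
  where
  vanish : ∀ j → expTerm 0ℚ (suc j) ≡ 0ℚ
  vanish j = trans (cong (_* inv (ℕtoℚ (suc j !))) (ℚ.*-zeroˡ (powℚ 0ℚ j))) (ℚ.*-zeroˡ (inv (ℕtoℚ (suc j !))))

-- Each step of 1/2 in the exponent at most doubles the bound, a form of e^(1/2) ≤ 2.
expPartial-half : ∀ r m → expPartial (ℕtoℚ r * ½) m ≤ ℕtoℚ (2 ℕ.^ r)
expPartial-half zero    = expPartial-0
expPartial-half (suc r) m = subst₂ (λ y B → expPartial y m ≤ B) r½ 2^
  (expPartial-+½ (*-nonNeg (0≤ℕtoℚ r) (ℚ.nonNegative⁻¹ ½)) (0≤ℕtoℚ (2 ℕ.^ r)) (expPartial-half r) m)
  where
  open ≡-Reasoning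
  r½ : ℕtoℚ r * ½ + ½ ≡ ℕtoℚ (suc r) * ½
  r½ = begin
    ℕtoℚ r * ½ + ½        ≡⟨ ℚ.+-comm (ℕtoℚ r * ½) ½ ⟩
    1ℚ * ½ + ℕtoℚ r * ½   ≡⟨ ℚ.*-distribʳ-+ ½ 1ℚ (ℕtoℚ r) ⟨
    (1ℚ + ℕtoℚ r) * ½     ≡⟨ cong (_* ½) (ℕtoℚ-+ 1 r) ⟨
    ℕtoℚ (suc r) * ½      ∎
  2^ : ℕtoℚ (2 ℕ.^ r) + ℕtoℚ (2 ℕ.^ r) ≡ ℕtoℚ (2 ℕ.^ suc r)
  2^ = trans (sym (ℕtoℚ-+ (2 ℕ.^ r) (2 ℕ.^ r))) (cong (λ z → ℕtoℚ (2 ℕ.^ r ℕ.+ z)) (sym (ℕ.+-identityʳ _)))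

-- ln n ≥ r/2 as soon as 2^r ≤ n; nonnegativity of `y` permits a comparison of the series term by
-- term.
LeLn-half : ∀ {y r n} → 0ℚ ≤ y → y ≤ ℕtoℚ r * ½ → 2 ℕ.^ r ℕ.≤ n → LeLn y n
LeLn-half {y} {r} 0≤y y≤r/2 2^r≤n m = ℚ.≤-trans
  (sumℚ-mono (upTo m) λ j → ℚ.*-monoʳ-≤-nonNeg (inv (ℕtoℚ (j !))) {{ℚ.nonNegative (0≤inv! j)}} (powℚ-mono j 0≤y y≤r/2))
  (ℚ.≤-trans (expPartial-half r m) (ℕtoℚ-mono-≤ 2^r≤n))

-- The instance

State : ℕ → Set
State n = (Fin n → Bool) × ℚ

init : State n
init = (λ _ → false) , 0ℚ

-- Names the local loop of KPWeight, which Agda finds by unification.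
mutual
  runKP : (I : Instance n) → MWMOracle I → Permutation′ n → ℕ → List (Fin n) → State n → ℚ
  runKP = _

  KPWeight≡runKP : ∀ (I : Instance n) (O : MWMOracle I) π τ → KPWeight I O π τ ≡ runKP I O π τ (allFin n) init
  -- Abstracting the list and the state turns them into variables, so that unification has a unique
  -- solution for `runKP`.
  KPWeight≡runKP {n} I O π τ with allFin n | init {n}
  ... | ts | s = refl

seen : Permutation′ n → ℕ → Fin n → Fin n → Bool
seen π τ v y = (toℕ (π ⟨$⟩ʳ y) <ᵇ τ) ∨ does (y ≟ v)

accept : Instance n → Fin n → Maybe (Fin n) → State n → State n
accept I v nothing  s            = s
accept I v (just u) (used , tot) =
  if used u then (used , tot) else ((λ x → used x ∨ does (x ≟ u)) , tot + Instance.w I v u)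

KPStep≡ : ∀ (I : Instance n) (O : MWMOracle I) π τ t s →
  KPStep I O π τ t s ≡ (if toℕ t <ᵇ τ then s else
    accept I (π ⟨$⟩ˡ t) (MWMOracle.pick O (seen π τ (π ⟨$⟩ˡ t)) (π ⟨$⟩ˡ t)) s)
KPStep≡ I O π τ t s with toℕ t <ᵇ τ
... | true = refl
... | false with MWMOracle.pick O (seen π τ (π ⟨$⟩ˡ t)) (π ⟨$⟩ˡ t)
...   | nothing = refl
...   | just u  = refl

-- Since `runKP` returns only a weight, the final state is supplied existentially. The invariant has
-- to survive only the arrivals after the sample.
runKP-invariant : ∀ (I : Instance n) (O : MWMOracle I) π τ (Inv : State n → Set) →
  (∀ t s → τ ℕ.≤ toℕ t → Inv s → Inv (accept I (π ⟨$⟩ˡ t) (MWMOracle.pick O (seen π τ (π ⟨$⟩ˡ t)) (π ⟨$⟩ˡ t)) s)) →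
  ∀ ts s → Inv s → ∃ λ s′ → Inv s′ × runKP I O π τ ts s ≡ proj₂ s′
runKP-invariant I O π τ Inv step []       s inv = s , inv , refl
runKP-invariant I O π τ Inv step (t ∷ ts) s inv =
  runKP-invariant I O π τ Inv step ts (KPStep I O π τ t s) (subst Inv (sym (KPStep≡ I O π τ t s)) (inv′ (toℕ t <ᵇ τ) refl))
  where
  accepted = accept I (π ⟨$⟩ˡ t) (MWMOracle.pick O (seen π τ (π ⟨$⟩ˡ t)) (π ⟨$⟩ˡ t)) s
  inv′ : ∀ b → (toℕ t <ᵇ τ) ≡ b → Inv (if b then s else accepted)
  inv′ true  _  = inv
  inv′ false eq = step t s (ℕ.≮⇒≥ λ t<τ → contradiction (trans (sym (<⇒<ᵇ≡true t<τ)) eq) λ ()) inv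

_[_≔_] : Matching n → Fin n → Maybe (Fin n) → Matching n
(M [ v ≔ m ]) x = if does (x ≟ v) then m else M x

≔-hit : ∀ (M : Matching n) v m → (M [ v ≔ m ]) v ≡ m
≔-hit M v m rewrite dec-true (v ≟ v) refl = refl

≔-miss : ∀ (M : Matching n) {v x} m → x ≢ v → (M [ v ≔ m ]) x ≡ M x
≔-miss M {v} {x} m x≢v rewrite dec-false (x ≟ v) x≢v = refl

≔-valid : ∀ {I : Instance n} {S M} v u → ValidIn I S M → S v ≡ true → Instance.adj I v u ≡ true →
  (∀ x → x ≢ v → M x ≢ just u) → ValidIn I S (M [ v ≔ just u ])
≔-valid {n} {I} {S} {M} v u (edges , injective) Sv adj free = edges′ , injective′
  where
  edges′ : ∀ x z → (M [ v ≔ just u ]) x ≡ just z → (S x ≡ true) × (Instance.adj I x z ≡ true)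
  edges′ x z eq with x ≟ v
  edges′ x z refl | yes refl = Sv , adj
  edges′ x z eq   | no _     = edges x z eq
  injective′ : ∀ x y z → (M [ v ≔ just u ]) x ≡ just z → (M [ v ≔ just u ]) y ≡ just z → x ≡ y
  injective′ x y z ex ey with x ≟ v | y ≟ v
  injective′ x y z ex   ey   | yes x≡v | yes y≡v = trans x≡v (sym y≡v)
  injective′ x y z refl ey   | yes _   | no y≢v  = contradiction ey (free y y≢v)
  injective′ x y z ex   refl | no x≢v  | yes _   = contradiction ex (free x x≢v)
  injective′ x y z ex   ey   | no _    | no _    = injective x y z ex ey

-- Offline vertex j < ξ is special: every online vertex v ≥ ξ is adjacent to it, with a weight that
-- increases with the arrival time of v under P j. The only other edges are the n ∸ ξ edges (v , v)
-- with v ≥ ξ, of weight n.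
module HardInstance (n ξ : ℕ) (ξ≤n : ξ ℕ.≤ n) (P : ℕ → Permutation′ n) where

  -- Applied to an online vertex, this marks the isolated ones: the offline vertex of the same index
  -- is special and cannot serve as a private vertex.
  special : Fin n → Bool
  special u = toℕ u <ᵇ ξ

  -- The weight of an edge to a special vertex lies between n + 1 and 2 n: always above the private
  -- weight, yet at most twice as large.
  weightℕ : Fin n → Fin n → ℕ
  weightℕ v u = if special u then suc (n ℕ.+ toℕ (P (toℕ u) ⟨$⟩ʳ v)) else n

  I : Instance n
  I = record
    { adj = λ v u → not (special v) ∧ (special u ∨ does (u ≟ v))
    ; w   = λ v u → ℕtoℚ (weightℕ v u)
    ; w≥0 = λ v u → 0≤ℕtoℚ (weightℕ v u)
    }

  open Instance I using (adj)

  adj-special : ∀ {v u} → special v ≡ false → special u ≡ true → adj v u ≡ true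
  adj-special ¬sv su rewrite ¬sv | su = refl

  adj-self : ∀ {v} → special v ≡ false → adj v v ≡ true
  adj-self {v} ¬sv rewrite ¬sv | dec-true (v ≟ v) refl = refl

  adj⇒¬special : ∀ {v u} → adj v u ≡ true → special v ≡ false
  adj⇒¬special {v} a with special v
  ... | false = refl

  adj⇒≡ : ∀ {v u} → adj v u ≡ true → special u ≡ false → u ≡ v
  adj⇒≡ {v} {u} a ¬su rewrite ¬su with special v | u ≟ v
  ... | false | yes u≡v = u≡v

  weightℕ-regular : ∀ {v u} → special u ≡ false → weightℕ v u ≡ n
  weightℕ-regular ¬su rewrite ¬su = refl

  weightℕ-special : ∀ {v u} → special u ≡ true → weightℕ v u ≡ suc (n ℕ.+ toℕ (P (toℕ u) ⟨$⟩ʳ v))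
  weightℕ-special su rewrite su = refl

  weightℕ≤ : ∀ v u → weightℕ v u ℕ.≤ n ℕ.+ n
  weightℕ≤ v u with special u
  ... | true  = ℕ.≤-trans (ℕ.≤-reflexive (sym (ℕ.+-suc n _))) (ℕ.+-monoʳ-≤ n (Fin.toℕ<n (P (toℕ u) ⟨$⟩ʳ v)))
  ... | false = ℕ.m≤m+n n n

  value : Fin n → Maybe (Fin n) → ℕ
  value v = maybe (weightℕ v) 0

  size : Matching n → ℕ
  size M = ∑ (allFin n) (λ v → value v (M v))

  weight≡size : ∀ M → weight I M ≡ ℕtoℚ (size M)
  weight≡size M = sumℚ-ℕtoℚ (allFin n) (λ v → eq v (M v))
    where
    eq : ∀ v m → maybe (Instance.w I v) 0ℚ m ≡ ℕtoℚ (value v m)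
    eq v nothing  = refl
    eq v (just u) = refl

  size-≔ : ∀ M v m → size (M [ v ≔ m ]) ℕ.+ value v (M v) ≡ size M ℕ.+ value v m
  size-≔ M v m = trans
    (∑-update v (λ x → value x (M x)) (λ x → value x ((M [ v ≔ m ]) x)) (λ x x≢v → cong (value x) (≔-miss M m x≢v)))
    (cong (λ z → size M ℕ.+ value v z) (≔-hit M v m))

  module _ (O : MWMOracle I) where
    open MWMOracle O

    size-maximum : ∀ S M → ValidIn I S M → size M ℕ.≤ size (pick S)
    size-maximum S M valid = ℕtoℚ-cancel-≤ (subst₂ _≤_ (weight≡size M) (weight≡size (pick S)) (maximum S M valid))

    -- Otherwise v is matched along (v , v). Moving v to the special vertex j, and the earlier vertex x
    -- that may occupy j back to (x , x), would increase the weight.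
    tentative-special : ∀ {j} → j ℕ.< ξ → ∀ τ v → τ ℕ.≤ toℕ (P j ⟨$⟩ʳ v) →
      ∀ u → pick (seen (P j) τ v) v ≡ just u → special u ≡ true
    tentative-special {j} j<ξ τ v τ≤v u Mv≡u = decide (special u) refl
      where
      π = P j
      S = seen π τ v
      M = pick S
      s : Fin n
      s = fromℕ< (ℕ.<-≤-trans j<ξ ξ≤n)
      s≡j : toℕ s ≡ j
      s≡j = Fin.toℕ-fromℕ< (ℕ.<-≤-trans j<ξ ξ≤n)
      s-special : special s ≡ true
      s-special = <⇒<ᵇ≡true (subst (ℕ._< ξ) (sym s≡j) j<ξ)
      weight-s : ∀ y → weightℕ y s ≡ suc (n ℕ.+ toℕ (π ⟨$⟩ʳ y))
      weight-s y = trans (weightℕ-special s-special) (cong (λ i → suc (n ℕ.+ toℕ (P i ⟨$⟩ʳ y))) s≡j)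
      Sv : S v ≡ true
      Sv rewrite dec-true (v ≟ v) refl = ∨-zeroʳ _

      decide : ∀ b → special u ≡ b → special u ≡ true
      decide true  su  = su
      decide false ¬su = contradiction improvement (ℕ.<⇒≱ (s≤s ℕ.≤-refl))
        where
        u≡v : u ≡ v
        u≡v = adj⇒≡ (proj₂ (proj₁ (valid S) v u Mv≡u)) ¬su
        v-regular : special v ≡ false
        v-regular = subst (λ x → special x ≡ false) u≡v ¬su
        Mv : M v ≡ just v
        Mv = trans Mv≡u (cong just u≡v)
        value-v : value v (M v) ≡ n
        value-v = trans (cong (value v) Mv) (weightℕ-regular v-regular)

        improvement : suc (size M) ℕ.≤ size M
        improvement with Fin.any? (λ x → Maybe.≡-dec _≟_ (M x) (just s))
        -- If `s` is free, `v` exchanges weight n for at least n + 1.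
        ... | no free = ℕ.+-cancelʳ-≤ n _ _ (begin
            suc (size M) ℕ.+ n                             ≤⟨ ℕ.≤-reflexive (sym (ℕ.+-suc (size M) n)) ⟩
            size M ℕ.+ suc n                               ≤⟨ ℕ.+-monoʳ-≤ (size M) (s≤s (ℕ.m≤m+n n _)) ⟩
            size M ℕ.+ suc (n ℕ.+ toℕ (π ⟨$⟩ʳ v))          ≡⟨ cong (size M ℕ.+_) (weight-s v) ⟨
            size M ℕ.+ value v (just s)                    ≡⟨ size-≔ M v (just s) ⟨
            size (M [ v ≔ just s ]) ℕ.+ value v (M v)      ≡⟨ cong (size (M [ v ≔ just s ]) ℕ.+_) value-v ⟩
            size (M [ v ≔ just s ]) ℕ.+ n                  ≤⟨ ℕ.+-monoˡ-≤ n (size-maximum S _ (≔-valid {I = I} v s (valid S) Sv (adj-special v-regular s-special)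
                                                                (λ x _ Mx → free (x , Mx)))) ⟩
            size M ℕ.+ n                                   ∎)
          where open ℕ.≤-Reasoning
        -- The net gain is the arrival time of `v` minus that of `x`. The cancelled summand consists
        -- of the two weights given up, `n` by `v` and `value x (just s)` by `x`.
        ... | yes (x , Mx) = ℕ.+-cancelʳ-≤ (n ℕ.+ value x (just s)) _ _ (begin
            suc (size M) ℕ.+ (n ℕ.+ value x (just s))      ≡⟨ ℕ.+-suc (size M) _ ⟨
            size M ℕ.+ suc (n ℕ.+ value x (just s))        ≡⟨ cong (size M ℕ.+_) (ℕ.+-suc n _) ⟨
            size M ℕ.+ (n ℕ.+ suc (value x (just s)))      ≤⟨ ℕ.+-monoʳ-≤ (size M) (ℕ.+-monoʳ-≤ n later) ⟩
            size M ℕ.+ (n ℕ.+ value v (just s))            ≡⟨ ℕ.+-assoc (size M) n _ ⟨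
            size M ℕ.+ n ℕ.+ value v (just s)              ≡⟨ cong (λ z → size M ℕ.+ z ℕ.+ value v (just s)) (weightℕ-regular {x} x-regular) ⟨
            size M ℕ.+ value x (just x) ℕ.+ value v (just s)
                                                           ≡⟨ cong (ℕ._+ value v (just s)) (size-≔ M x (just x)) ⟨
            size M₁ ℕ.+ value x (M x) ℕ.+ value v (just s) ≡⟨ cong (λ z → size M₁ ℕ.+ value x z ℕ.+ value v (just s)) Mx ⟩
            size M₁ ℕ.+ value x (just s) ℕ.+ value v (just s)
                                                           ≡⟨ swap-last (size M₁) _ _ ⟩
            size M₁ ℕ.+ value v (just s) ℕ.+ value x (just s)
                                                           ≡⟨ cong (ℕ._+ value x (just s)) (size-≔ M₁ v (just s)) ⟨
            size M₂ ℕ.+ value v (M₁ v) ℕ.+ value x (just s) ≡⟨ cong (λ z → size M₂ ℕ.+ z ℕ.+ value x (just s)) (trans (cong (value v) (≔-miss M (just x) v≢x)) value-v) ⟩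
            size M₂ ℕ.+ n ℕ.+ value x (just s)             ≡⟨ ℕ.+-assoc (size M₂) n _ ⟩
            size M₂ ℕ.+ (n ℕ.+ value x (just s))           ≤⟨ ℕ.+-monoˡ-≤ _ (size-maximum S M₂ M₂-valid) ⟩
            size M ℕ.+ (n ℕ.+ value x (just s))            ∎)
          where
          open ℕ.≤-Reasoning
          swap-last : ∀ a b c → a ℕ.+ b ℕ.+ c ≡ a ℕ.+ c ℕ.+ b
          swap-last = solve-∀
          M₁ = M [ x ≔ just x ]
          M₂ = M₁ [ v ≔ just s ]
          Sx : S x ≡ true
          Sx = proj₁ (proj₁ (valid S) x s Mx)
          x-regular : special x ≡ false
          x-regular = adj⇒¬special {x} {s} (proj₂ (proj₁ (valid S) x s Mx))
          s≢regular : ∀ {y} → special y ≡ false → s ≢ y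
          s≢regular ¬sy refl with () ← trans (sym s-special) ¬sy
          v≢x : v ≢ x
          v≢x refl = s≢regular v-regular (Maybe.just-injective (trans (sym Mx) Mv))
          -- Apart from `v`, only sampled vertices are present, so `x` belongs to the sample and
          -- arrives before `v`.
          early : ∀ b → b ∨ does (x ≟ v) ≡ true → b ≡ true
          early true  _ = refl
          early false eq with x ≟ v
          ... | yes x≡v = contradiction (sym x≡v) v≢x
          x<v : toℕ (π ⟨$⟩ʳ x) ℕ.< toℕ (π ⟨$⟩ʳ v)
          x<v = ℕ.<-≤-trans (<ᵇ≡true⇒< _ τ (early _ Sx)) τ≤v
          later : suc (value x (just s)) ℕ.≤ value v (just s)
          later = subst₂ (λ a b → suc a ℕ.≤ b) (sym (weight-s x)) (sym (weight-s v)) (s≤s (ℕ.+-monoʳ-< n x<v))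
          -- The private vertex of `x` is free, since no other online vertex is adjacent to it.
          M₁-valid : ValidIn I S M₁
          M₁-valid = ≔-valid {I = I} x x (valid S) Sx (adj-self x-regular) λ z z≢x Mz →
            z≢x (sym (adj⇒≡ {z} {x} (proj₂ (proj₁ (valid S) z x Mz)) x-regular))
          M₂-valid : ValidIn I S M₂
          M₂-valid = ≔-valid {I = I} v s M₁-valid Sv (adj-special v-regular s-special) λ z _ M₁z → held z M₁z
            where
            held : ∀ z → M₁ z ≢ just s
            held z M₁z with z ≟ x
            ... | yes refl = s≢regular x-regular (sym (Maybe.just-injective M₁z))
            ... | no z≢x   = z≢x (proj₂ (valid S) z x s M₁z Mx)

    -- Weight of the algorithm's matching and of the optimum

    occupied : (Fin n → Bool) → ℕ
    occupied used = ∑ (allFin ξ) (λ i → 𝟙 (used (inject≤ i ξ≤n)))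

    -- Each accepted edge occupies a fresh special vertex and adds at most 2 n.
    Bounded : State n → Set
    Bounded (used , tot) = (0ℚ ≤ tot) × (tot ≤ ℕtoℚ (occupied used ℕ.* (n ℕ.+ n)))

    occupied-insert : ∀ used u → special u ≡ true → used u ≡ false →
      occupied (λ x → used x ∨ does (x ≟ u)) ≡ suc (occupied used)
    occupied-insert used u su ¬used = begin
      occupied used′              ≡⟨ ℕ.+-identityʳ _ ⟨
      occupied used′ ℕ.+ 0        ≡⟨ cong (λ b → occupied used′ ℕ.+ 𝟙 b) (trans (cong used i≡u) ¬used) ⟨
      occupied used′ ℕ.+ 𝟙 (used (inject≤ i ξ≤n))
                                  ≡⟨ ∑-update i (λ i → 𝟙 (used (inject≤ i ξ≤n))) (λ i → 𝟙 (used′ (inject≤ i ξ≤n))) off ⟩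
      occupied used ℕ.+ 𝟙 (used′ (inject≤ i ξ≤n))
                                  ≡⟨ cong (λ x → occupied used ℕ.+ 𝟙 (used′ x)) i≡u ⟩
      occupied used ℕ.+ 𝟙 (used u ∨ does (u ≟ u))
                                  ≡⟨ cong (λ b → occupied used ℕ.+ 𝟙 b) (trans (cong (used u ∨_) (dec-true (u ≟ u) refl)) (∨-zeroʳ (used u))) ⟩
      occupied used ℕ.+ 1         ≡⟨ ℕ.+-comm (occupied used) 1 ⟩
      suc (occupied used)         ∎
      where
      open ≡-Reasoning
      used′ : Fin n → Bool
      used′ x = used x ∨ does (x ≟ u)
      u<ξ : toℕ u ℕ.< ξ
      u<ξ = <ᵇ≡true⇒< (toℕ u) ξ su
      i : Fin ξ
      i = fromℕ< u<ξ
      i≡u : inject≤ i ξ≤n ≡ u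
      i≡u = Fin.toℕ-injective (trans (Fin.toℕ-inject≤ i ξ≤n) (Fin.toℕ-fromℕ< u<ξ))
      off : ∀ x → x ≢ i → 𝟙 (used′ (inject≤ x ξ≤n)) ≡ 𝟙 (used (inject≤ x ξ≤n))
      off x x≢i = cong 𝟙 (trans
        (cong (used (inject≤ x ξ≤n) ∨_) (dec-false (inject≤ x ξ≤n ≟ u) λ x≡u →
          x≢i (Fin.inject≤-injective ξ≤n ξ≤n x i (trans x≡u (sym i≡u)))))
        (∨-identityʳ _))

    accept-bounded : ∀ v m → (∀ u → m ≡ just u → special u ≡ true) → ∀ s → Bounded s → Bounded (accept I v m s)
    accept-bounded v nothing  m-special s            b = b
    accept-bounded v (just u) m-special (used , tot) b@(0≤tot , tot≤) = on (used u) refl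
      where
      open ℚ.≤-Reasoning
      used′ : Fin n → Bool
      used′ x = used x ∨ does (x ≟ u)
      on : ∀ c → used u ≡ c → Bounded (if c then (used , tot) else (used′ , tot + ℕtoℚ (weightℕ v u)))
      on true  _     = b
      on false ¬used = +-nonNeg 0≤tot (0≤ℕtoℚ (weightℕ v u)) , (begin
        tot + ℕtoℚ (weightℕ v u)                                     ≤⟨ ℚ.+-mono-≤ tot≤ (ℕtoℚ-mono-≤ (weightℕ≤ v u)) ⟩
        ℕtoℚ (occupied used ℕ.* (n ℕ.+ n)) + ℕtoℚ (n ℕ.+ n)          ≡⟨ ℕtoℚ-+ (occupied used ℕ.* (n ℕ.+ n)) (n ℕ.+ n) ⟨
        ℕtoℚ (occupied used ℕ.* (n ℕ.+ n) ℕ.+ (n ℕ.+ n))             ≡⟨ cong ℕtoℚ (ℕ.+-comm _ (n ℕ.+ n)) ⟩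
        ℕtoℚ (suc (occupied used) ℕ.* (n ℕ.+ n))                     ≡⟨ cong (λ z → ℕtoℚ (z ℕ.* (n ℕ.+ n))) (occupied-insert used u (m-special u refl) ¬used) ⟨
        ℕtoℚ (occupied used′ ℕ.* (n ℕ.+ n))                          ∎)

    -- As this holds for every τ, averaging over τ needs of the binomial weights only that they are
    -- nonnegative with sum at most 1.
    KPWeight-bounds : ∀ {j} → j ℕ.< ξ → ∀ τ → (0ℚ ≤ KPWeight I O (P j) τ) × (KPWeight I O (P j) τ ≤ ℕtoℚ (ξ ℕ.* (n ℕ.+ n)))
    KPWeight-bounds {j} j<ξ τ
      with s , (0≤ , ≤occ) , eq ← runKP-invariant I O (P j) τ Bounded
             (λ t s τ≤t → accept-bounded (P j ⟨$⟩ˡ t) _ (tentative-special j<ξ τ (P j ⟨$⟩ˡ t)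
               (subst (λ x → τ ℕ.≤ toℕ x) (sym (Perm.inverseʳ (P j))) τ≤t)) s)
             (allFin n) init (ℚ.≤-refl , 0≤ℕtoℚ (occupied (λ _ → false) ℕ.* (n ℕ.+ n)))
      rewrite KPWeight≡runKP I O (P j) τ | eq = 0≤ , ℚ.≤-trans ≤occ (ℕtoℚ-mono-≤ (ℕ.*-monoˡ-≤ (n ℕ.+ n) (occupied≤ (proj₁ s))))
      where
      occupied≤ : ∀ used → occupied used ℕ.≤ ξ
      occupied≤ used = ℕ.≤-trans (∑-mono (allFin ξ) (λ i → 𝟙-mono {used (inject≤ i ξ≤n)} {true} (λ _ → refl)))
        (ℕ.≤-reflexive (trans (∑-allFin-const ξ 1) (ℕ.*-identityʳ ξ)))

    OPT≥ : ℕtoℚ ((n ℕ.∸ ξ) ℕ.* n) ≤ OPT O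
    OPT≥ = subst (ℕtoℚ ((n ℕ.∸ ξ) ℕ.* n) ≤_) (sym (weight≡size (pick (λ _ → true)))) (ℕtoℚ-mono-≤
      (ℕ.≤-trans diagonal-size (size-maximum (λ _ → true) diagonal diagonal-valid)))
      where
      diagonal : Matching n
      diagonal v = if special v then nothing else just v
      diagonal-valid : ValidIn I (λ _ → true) diagonal
      diagonal-valid = (λ v u eq → refl , edge v u eq) , λ v v′ u eq eq′ → trans (own v u eq) (sym (own v′ u eq′))
        where
        own : ∀ v u → diagonal v ≡ just u → v ≡ u
        own v u eq with special v
        own v u refl | false = refl
        regular : ∀ v u → diagonal v ≡ just u → special v ≡ false
        regular v u eq with special v
        ... | false = refl
        edge : ∀ v u → diagonal v ≡ just u → adj v u ≡ true
        edge v u eq = subst (λ x → adj v x ≡ true) (own v u eq) (adj-self (regular v u eq))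
      -- A credit of n for each of the at most ξ isolated vertices makes every summand equal to n
      -- and the total equal to n².
      split : ∀ v → n ≡ value v (diagonal v) ℕ.+ n ℕ.* 𝟙 (special v)
      split v with special v in sv
      ... | true  = sym (ℕ.*-identityʳ n)
      ... | false rewrite sv = sym (trans (cong (n ℕ.+_) (ℕ.*-zeroʳ n)) (ℕ.+-identityʳ n))
      specials≤ : ∀ m → ∑ (allFin m) (λ v → 𝟙 (toℕ v <ᵇ ξ)) ℕ.≤ ξ
      specials≤ m = below m ξ
        where
        below : ∀ m ξ → ∑ (allFin m) (λ v → 𝟙 (toℕ v <ᵇ ξ)) ℕ.≤ ξ
        below zero    ξ       = z≤n
        below (suc m) zero    = ℕ.≤-reflexive (trans (∑-allFin-const (suc m) 0) (ℕ.*-zeroʳ m))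
        below (suc m) (suc ξ) = ℕ.≤-trans (ℕ.≤-reflexive (∑-allFin-suc {m} (λ v → 𝟙 (toℕ v <ᵇ suc ξ)))) (s≤s (below m ξ))
      diagonal-size : (n ℕ.∸ ξ) ℕ.* n ℕ.≤ size diagonal
      diagonal-size = ℕ.+-cancelʳ-≤ (ξ ℕ.* n) _ _ (begin
        (n ℕ.∸ ξ) ℕ.* n ℕ.+ ξ ℕ.* n                      ≡⟨ ℕ.*-distribʳ-+ n (n ℕ.∸ ξ) ξ ⟨
        (n ℕ.∸ ξ ℕ.+ ξ) ℕ.* n                            ≡⟨ cong (ℕ._* n) (ℕ.m∸n+n≡m ξ≤n) ⟩
        n ℕ.* n                                          ≡⟨ ∑-allFin-const n n ⟨
        ∑ (allFin n) (λ _ → n)                           ≡⟨ ∑-cong (allFin n) split ⟩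
        ∑ (allFin n) (λ v → value v (diagonal v) ℕ.+ n ℕ.* 𝟙 (special v))
                                                         ≡⟨ ∑-+ (allFin n) (λ v → value v (diagonal v)) _ ⟩
        size diagonal ℕ.+ ∑ (allFin n) (λ v → n ℕ.* 𝟙 (special v))
                                                         ≡⟨ cong (size diagonal ℕ.+_) (∑-* (allFin n) n _) ⟩
        size diagonal ℕ.+ n ℕ.* ∑ (allFin n) (𝟙 ∘ special)
                                                         ≤⟨ ℕ.+-monoʳ-≤ (size diagonal) (ℕ.*-monoʳ-≤ n (specials≤ n)) ⟩
        size diagonal ℕ.+ n ℕ.* ξ                        ≡⟨ cong (size diagonal ℕ.+_) (ℕ.*-comm n ξ) ⟩
        size diagonal ℕ.+ ξ ℕ.* n                        ∎)
        where open ℕ.≤-Reasoning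

-- The distribution

-- The mass `r` is separate from the length so that induction on the length leaves it fixed; r = 1/ξ
-- at length ξ gives the uniform distribution on the list.
prefix : ℚ → (ℕ → Permutation′ n) → ℕ → Dist n
prefix r P zero    = []
prefix r P (suc t) = (r , P t) ∷ prefix r P t

prefix-nonNeg : ∀ {r} → 0ℚ ≤ r → ∀ (P : ℕ → Permutation′ n) t → NonNegList (prefix r P t)
prefix-nonNeg 0≤r P zero    = tt
prefix-nonNeg 0≤r P (suc t) = 0≤r , prefix-nonNeg 0≤r P t

probOf-prefix : ∀ r (P : ℕ → Permutation′ n) E t → probOf (prefix r P t) E ≡ ℕtoℚ (hits (E ∘ P) t) * r
probOf-prefix r P E zero    = sym (ℚ.*-zeroˡ r)
probOf-prefix r P E (suc t) = begin
  (if E (P t) then r else 0ℚ) + probOf (prefix r P t) E       ≡⟨ cong₂ _+_ (indicator (E (P t))) (probOf-prefix r P E t) ⟩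
  ℕtoℚ (𝟙 (E (P t))) * r + ℕtoℚ (hits (E ∘ P) t) * r          ≡⟨ ℚ.*-distribʳ-+ r (ℕtoℚ (𝟙 (E (P t)))) _ ⟨
  (ℕtoℚ (𝟙 (E (P t))) + ℕtoℚ (hits (E ∘ P) t)) * r            ≡⟨ cong (_* r) (ℕtoℚ-+ (𝟙 (E (P t))) (hits (E ∘ P) t)) ⟨
  ℕtoℚ (hits (E ∘ P) (suc t)) * r                             ∎
  where
  open ≡-Reasoning
  indicator : ∀ b → (if b then r else 0ℚ) ≡ ℕtoℚ (𝟙 b) * r
  indicator true  = sym (ℚ.*-identityˡ r)
  indicator false = sym (ℚ.*-zeroˡ r)

prefix-isDist : ∀ (P : ℕ → Permutation′ n) {t} → 0 ℕ.< t → IsDist (prefix (inv (ℕtoℚ t)) P t)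
prefix-isDist P {t} 0<t = prefix-nonNeg (0≤inv (0<ℕtoℚ 0<t)) P t , (begin
  probOf (prefix r P t) (λ _ → true)    ≡⟨ probOf-prefix r P (λ _ → true) t ⟩
  ℕtoℚ (hits (λ _ → true) t) * r        ≡⟨ cong (λ z → ℕtoℚ z * r) (always t) ⟩
  ℕtoℚ t * r                            ≡⟨ *-inv (0<ℕtoℚ 0<t) ⟩
  1ℚ                                    ∎)
  where
  open ≡-Reasoning
  r = inv (ℕtoℚ t)
  always : ∀ t → hits (λ _ → true) t ≡ t
  always zero    = refl
  always (suc t) = cong suc (always t)

module _ (I : Instance n) (O : MWMOracle I) where

  sampledWeight : Permutation′ n → ℚ
  sampledWeight π = sumℚ (map (λ τ → binomProb n τ * KPWeight I O π τ) (upTo (suc n)))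

  sampledWeight-bounds : ∀ π B → (∀ τ → (0ℚ ≤ KPWeight I O π τ) × (KPWeight I O π τ ≤ B)) →
    (0ℚ ≤ sampledWeight π) × (sampledWeight π ≤ B)
  sampledWeight-bounds π B bound = sumℚ-nonNeg (upTo (suc n)) (λ τ → *-nonNeg (0≤binomProb n τ) (proj₁ (bound τ))) , (begin
    sampledWeight π
      ≤⟨ sumℚ-mono (upTo (suc n)) (λ τ → ℚ.*-monoˡ-≤-nonNeg (binomProb n τ) {{ℚ.nonNegative (0≤binomProb n τ)}} (proj₂ (bound τ))) ⟩
    sumℚ (map (λ τ → binomProb n τ * B) (upTo (suc n)))
      ≡⟨ sumℚ-*ʳ (upTo (suc n)) (binomProb n) B ⟩
    sumℚ (map (binomProb n) (upTo (suc n))) * B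
      ≤⟨ ℚ.*-monoʳ-≤-nonNeg B {{ℚ.nonNegative 0≤B}} (∑-binomProb≤1 n (suc n)) ⟩
    1ℚ * B
      ≡⟨ ℚ.*-identityˡ B ⟩
    B ∎)
    where
    open ℚ.≤-Reasoning
    0≤B : 0ℚ ≤ B
    0≤B = ℚ.≤-trans (proj₁ (bound 0)) (proj₂ (bound 0))

  ExpKP-prefix : ∀ {r} → 0ℚ ≤ r → ∀ (P : ℕ → Permutation′ n) B t →
    (∀ {j} → j ℕ.< t → ∀ τ → (0ℚ ≤ KPWeight I O (P j) τ) × (KPWeight I O (P j) τ ≤ B)) →
    (0ℚ ≤ ExpKP I O (prefix r P t)) × (ExpKP I O (prefix r P t) ≤ ℕtoℚ t * r * B)
  ExpKP-prefix {r} 0≤r P B zero    bound =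
    ℚ.≤-refl , ℚ.≤-reflexive (sym (trans (cong (_* B) (ℚ.*-zeroˡ r)) (ℚ.*-zeroˡ B)))
  ExpKP-prefix {r} 0≤r P B (suc t) bound =
    +-nonNeg (*-nonNeg 0≤r (proj₁ now)) (proj₁ earlier) , (begin
      r * sampledWeight (P t) + ExpKP I O (prefix r P t)   ≤⟨ ℚ.+-mono-≤ (ℚ.*-monoˡ-≤-nonNeg r {{ℚ.nonNegative 0≤r}} (proj₂ now)) (proj₂ earlier) ⟩
      r * B + ℕtoℚ t * r * B                               ≡⟨ ℚ.*-distribʳ-+ B r (ℕtoℚ t * r) ⟨
      (r + ℕtoℚ t * r) * B                                 ≡⟨ cong (λ z → (z + ℕtoℚ t * r) * B) (ℚ.*-identityˡ r) ⟨
      (1ℚ * r + ℕtoℚ t * r) * B                            ≡⟨ cong (_* B) (ℚ.*-distribʳ-+ r 1ℚ (ℕtoℚ t)) ⟨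
      (1ℚ + ℕtoℚ t) * r * B                                ≡⟨ cong (λ z → z * r * B) (ℕtoℚ-+ 1 t) ⟨
      ℕtoℚ (suc t) * r * B                                 ∎)
    where
    open ℚ.≤-Reasoning
    now : (0ℚ ≤ sampledWeight (P t)) × (sampledWeight (P t) ≤ B)
    now = sampledWeight-bounds (P t) B (bound ℕ.≤-refl)
    earlier : (0ℚ ≤ ExpKP I O (prefix r P t)) × (ExpKP I O (prefix r P t) ≤ ℕtoℚ t * r * B)
    earlier = ExpKP-prefix {r} 0≤r P B t (λ j<t → bound (ℕ.m≤n⇒m≤1+n j<t))

-- Choice of the parameters

log₂-bounds : ∀ n → 1 ℕ.≤ n → ∃ λ r → (2 ℕ.^ r ℕ.≤ n) × (n ℕ.< 2 ℕ.^ suc r)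
log₂-bounds (suc zero)    _ = 0 , ℕ.≤-refl , ℕ.≤-refl
log₂-bounds (suc n@(suc _)) _ with r , lo , hi ← log₂-bounds n (s≤s z≤n) with suc n ℕ.<? 2 ℕ.^ suc r
... | yes lt = r , ℕ.m≤n⇒m≤1+n lo , lt
... | no ≮   = suc r , ℕ.≮⇒≥ ≮ , ℕ.≤-<-trans hi (ℕ.^-monoʳ-< 2 (s≤s (s≤s z≤n)) (ℕ.n<1+n (suc r)))

-- With s = 7 + j this is s² ≤ 2^(s - 1), and 7 is the first s > 1 for which it holds.
square≤2^ : ∀ j → (7 ℕ.+ j) ℕ.* (7 ℕ.+ j) ℕ.≤ 2 ℕ.^ (6 ℕ.+ j)
square≤2^ zero    = toWitness {a? = 49 ℕ.≤? 64} _
square≤2^ (suc j) = begin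
  (7 ℕ.+ suc j) ℕ.* (7 ℕ.+ suc j)                                ≤⟨ ℕ.m≤m+n _ (34 ℕ.+ 12 ℕ.* j ℕ.+ j ℕ.* j) ⟩
  (7 ℕ.+ suc j) ℕ.* (7 ℕ.+ suc j) ℕ.+ (34 ℕ.+ 12 ℕ.* j ℕ.+ j ℕ.* j)  ≡⟨ expand j ⟩
  2 ℕ.* ((7 ℕ.+ j) ℕ.* (7 ℕ.+ j))                                ≤⟨ ℕ.*-monoʳ-≤ 2 (square≤2^ j) ⟩
  2 ℕ.^ (7 ℕ.+ j)                                                ≡⟨ cong (2 ℕ.^_) (ℕ.+-suc 6 j) ⟨
  2 ℕ.^ (6 ℕ.+ suc j)                                            ∎
  where
  open ℕ.≤-Reasoning
  expand : ∀ j → (7 ℕ.+ suc j) ℕ.* (7 ℕ.+ suc j) ℕ.+ (34 ℕ.+ 12 ℕ.* j ℕ.+ j ℕ.* j) ≡ 2 ℕ.* ((7 ℕ.+ j) ℕ.* (7 ℕ.+ j))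
  expand = solve-∀

-- Both factors are at most r + 1, whose square is at most 2^r.
linear≤2^ : ∀ M r → 6 ℕ.+ M ℕ.≤ r → M ℕ.* suc r ℕ.≤ 2 ℕ.^ r
linear≤2^ M r le with j , refl ← ℕ.m≤n⇒∃[o]m+o≡n (ℕ.m+n≤o⇒m≤o 6 le) = begin
  M ℕ.* suc (6 ℕ.+ j)              ≤⟨ ℕ.*-monoˡ-≤ (suc (6 ℕ.+ j)) (ℕ.≤-trans (ℕ.m≤n+m M 6) (ℕ.m≤n⇒m≤1+n le)) ⟩
  (7 ℕ.+ j) ℕ.* suc (6 ℕ.+ j)      ≤⟨ square≤2^ j ⟩
  2 ℕ.^ (6 ℕ.+ j)                  ∎
  where open ℕ.≤-Reasoning

fraction : ∀ δ → 0ℚ < δ → δ < 1ℚ → ∃ λ p → ∃ λ q → (0 ℕ.< p) × (p ℕ.≤ q) × (δ * ℕtoℚ q ≡ ℕtoℚ p)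
fraction δ@(mkℚ (pos zero) _ _) 0<δ _ = contradiction (ℚ.positive 0<δ) λ ()
fraction δ@(mkℚ -[1+ _ ] _ _)   0<δ _ = contradiction (ℚ.positive 0<δ) λ ()
fraction δ@(mkℚ +[1+ p ] q-1 _) 0<δ δ<1 = suc p , suc q-1 , s≤s z≤n , p≤q , δ*q
  where
  p≤q : suc p ℕ.≤ suc q-1
  p≤q = ℤ.drop‿+≤+ (subst₂ ℤ._≤_ (ℤ.*-identityʳ _) (ℤ.*-identityˡ _) (ℤ.<⇒≤ (ℚ.drop-*<* δ<1)))
  δ*q : δ * ℕtoℚ (suc q-1) ≡ ℕtoℚ (suc p)
  δ*q = ℚ.toℚᵘ-injective (begin-equality
    toℚᵘ (δ * ℕtoℚ (suc q-1))                   ≃⟨ ℚ.toℚᵘ-homo-* δ (ℕtoℚ (suc q-1)) ⟩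
    toℚᵘ δ ℚᵘ.* toℚᵘ (ℕtoℚ (suc q-1))           ≃⟨ ℚᵘ.*-cong {toℚᵘ δ} ℚᵘ.≃-refl (toℚᵘ-ℕtoℚ (suc q-1)) ⟩
    mkℚᵘ (pos (suc p)) q-1 ℚᵘ.* mkℚᵘ (pos (suc q-1)) 0  ≃⟨ *≡* (ℤ.*-assoc (pos (suc p)) (pos (suc q-1)) (pos 1)) ⟩
    mkℚᵘ (pos (suc p)) 0                        ≃⟨ toℚᵘ-ℕtoℚ (suc p) ⟨
    toℚᵘ (ℕtoℚ (suc p))                         ∎)
    where open ℚᵘ.≤-Reasoning

-- For δ = p/q the witness is d = ⌊q/p⌋ + 1. The lower bound makes the deviation 1/d at most δ; the
-- upper bound keeps d² within 4/δ².
approximate-inverse : ∀ δ → 0ℚ < δ → δ < 1ℚ → ∃ λ d′ → (1ℚ ≤ δ * ℕtoℚ (suc d′)) × (δ * ℕtoℚ (suc d′) ≤ ℕtoℚ 2)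
approximate-inverse δ 0<δ δ<1 with fraction δ 0<δ δ<1
... | suc p-1 , q@(suc q-1) , _ , p≤q , δq≡p = d′ , scaled q≤pd 1≤ , scaled pd≤2q ≤2
  where
  p = suc p-1
  d′ = q ℕ./ p
  D = ℕtoℚ (suc d′)
  q≡ : q ≡ q ℕ.% p ℕ.+ d′ ℕ.* p
  q≡ = ℕ.m≡m%n+[m/n]*n q p
  q≤pd : q ℕ.≤ suc d′ ℕ.* p
  q≤pd = ℕ.≤-trans (ℕ.≤-reflexive q≡) (ℕ.+-monoˡ-≤ (d′ ℕ.* p) (ℕ.<⇒≤ (ℕ.m%n<n q p)))
  pd≤2q : suc d′ ℕ.* p ℕ.≤ 2 ℕ.* q
  pd≤2q = ℕ.+-mono-≤ p≤q (ℕ.≤-trans (ℕ.m/n*n≤m q p) (ℕ.≤-reflexive (sym (ℕ.+-identityʳ q))))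
  scaled : ∀ {m m′ x y} → m ℕ.≤ m′ → (ℕtoℚ m ≤ ℕtoℚ m′ → x * ℕtoℚ q ≤ y * ℕtoℚ q) → x ≤ y
  scaled le f = ℚ.*-cancelʳ-≤-pos (ℕtoℚ q) {{ℚ.positive (0<ℕtoℚ {q} (s≤s z≤n))}} (f (ℕtoℚ-mono-≤ le))
  δDq : ℕtoℚ (suc d′ ℕ.* p) ≡ δ * D * ℕtoℚ q
  δDq = trans (ℕtoℚ-* (suc d′) p) (trans (cong (D *_) (sym δq≡p)) (swap D δ (ℕtoℚ q)))
    where
    swap : ∀ D δ q → D * (δ * q) ≡ δ * D * q
    swap = solveRing-∀ ℚ-ring
  1≤ : ℕtoℚ q ≤ ℕtoℚ (suc d′ ℕ.* p) → 1ℚ * ℕtoℚ q ≤ δ * D * ℕtoℚ q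
  1≤ = subst₂ _≤_ (sym (ℚ.*-identityˡ (ℕtoℚ q))) δDq
  ≤2 : ℕtoℚ (suc d′ ℕ.* p) ≤ ℕtoℚ (2 ℕ.* q) → δ * D * ℕtoℚ q ≤ ℕtoℚ 2 * ℕtoℚ q
  ≤2 = subst₂ _≤_ δDq (ℕtoℚ-* 2 q)

module _ {δ d′} (1≤δd : 1ℚ ≤ δ * ℕtoℚ (suc d′)) where

  1-δ≤ : (1ℚ - δ) * ℕtoℚ (suc d′) ≤ ℕtoℚ d′
  1-δ≤ = begin
    (1ℚ - δ) * D              ≡⟨ trans (ℚ.*-distribʳ-+ D 1ℚ (ℚ.- δ)) (cong₂ _+_ (ℚ.*-identityˡ D) (sym (ℚ.neg-distribˡ-* δ D))) ⟩
    D - δ * D                 ≤⟨ ℚ.+-monoʳ-≤ D (ℚ.neg-antimono-≤ 1≤δd) ⟩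
    D - 1ℚ                    ≡⟨ cong (_- 1ℚ) (trans (ℕtoℚ-+ 1 d′) (ℚ.+-comm 1ℚ (ℕtoℚ d′))) ⟩
    ℕtoℚ d′ + 1ℚ - 1ℚ         ≡⟨ trans (ℚ.+-assoc (ℕtoℚ d′) 1ℚ (ℚ.- 1ℚ)) (ℚ.+-identityʳ (ℕtoℚ d′)) ⟩
    ℕtoℚ d′                   ∎
    where
    open ℚ.≤-Reasoning
    D = ℕtoℚ (suc d′)

  frequency⇒probability : ∀ {K ξ h} → 0 ℕ.< K → 0 ℕ.< ξ → d′ ℕ.* ξ ℕ.≤ K ℕ.* suc d′ ℕ.* h →
    (1ℚ - δ) * inv (ℕtoℚ K) ≤ ℕtoℚ h * inv (ℕtoℚ ξ)
  frequency⇒probability {K} {ξ} {h} 0<K 0<ξ le = *inv-≤ (0<ℕtoℚ 0<K) (begin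
    1ℚ - δ                                  ≤⟨ ≤-*inv (0<ℕtoℚ 0<ξ) scaled ⟩
    ℕtoℚ K * ℕtoℚ h * inv (ℕtoℚ ξ)          ≡⟨ rotate (ℕtoℚ K) (ℕtoℚ h) _ ⟩
    ℕtoℚ h * inv (ℕtoℚ ξ) * ℕtoℚ K          ∎)
    where
    open ℚ.≤-Reasoning
    D = ℕtoℚ (suc d′)
    rotate : ∀ a b c → a * b * c ≡ b * c * a
    rotate = solveRing-∀ ℚ-ring
    swap : ∀ a b c → a * b * c ≡ a * c * b
    swap = solveRing-∀ ℚ-ring
    scaled : (1ℚ - δ) * ℕtoℚ ξ ≤ ℕtoℚ K * ℕtoℚ h
    scaled = ℚ.*-cancelʳ-≤-pos D {{ℚ.positive (0<ℕtoℚ {suc d′} (s≤s z≤n))}} (begin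
      (1ℚ - δ) * ℕtoℚ ξ * D              ≡⟨ swap (1ℚ - δ) (ℕtoℚ ξ) D ⟩
      (1ℚ - δ) * D * ℕtoℚ ξ              ≤⟨ ℚ.*-monoʳ-≤-nonNeg (ℕtoℚ ξ) {{ℚ.nonNegative (0≤ℕtoℚ ξ)}} 1-δ≤ ⟩
      ℕtoℚ d′ * ℕtoℚ ξ                   ≡⟨ ℕtoℚ-* d′ ξ ⟨
      ℕtoℚ (d′ ℕ.* ξ)                    ≤⟨ ℕtoℚ-mono-≤ le ⟩
      ℕtoℚ (K ℕ.* suc d′ ℕ.* h)          ≡⟨ trans (ℕtoℚ-* (K ℕ.* suc d′) h) (cong (_* ℕtoℚ h) (ℕtoℚ-* K (suc d′))) ⟩
      ℕtoℚ K * D * ℕtoℚ h                ≡⟨ swap (ℕtoℚ K) D (ℕtoℚ h) ⟩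
      ℕtoℚ K * ℕtoℚ h * D                ∎)

-- The competitive ratio

-- 384 = 6 · 2 · 4 · 2 · 2 · 2: the factor 6 in `support`, weights up to 2 n, (δ d)² ≤ 4, n - ξ ≥
-- n/2, r + 1 ≤ 2 r, and ln n ≥ r/2.
constant : ℚ
constant = inv (ℕtoℚ 384)

constant>0 : 0ℚ < constant
constant>0 = 0<inv (0<ℕtoℚ {384} (s≤s z≤n))

module _ (k d r n : ℕ) (1≤r : 1 ℕ.≤ r) where
  private
    g = suc r
    ξ = support k d g
    U = n ℕ.* (k ! ℕ.* (6 ℕ.* (k ℕ.* g))) ℕ.* (n ℕ.+ n)
    V = r ℕ.* (suc k ! ℕ.* ((n ℕ.∸ ξ) ℕ.* n))

  integer-comparison : 2 ℕ.* ξ ℕ.≤ n → 8 ℕ.* U ℕ.≤ 384 ℕ.* V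
  integer-comparison 2ξ≤n = begin
    8 ℕ.* U                                             ≡⟨ left 8 6 n (k !) k g ⟩
    -- The factor k from the union over tuples is absorbed by (k+1)! = k! + k · k!.
    96 ℕ.* (k ℕ.* k ! ℕ.* (g ℕ.* (n ℕ.* n)))            ≤⟨ ℕ.*-monoʳ-≤ 96 (ℕ.*-mono-≤ (ℕ.m≤n+m (k ℕ.* k !) (k !)) (ℕ.*-mono-≤ g≤2r (ℕ.*-monoˡ-≤ n n≤))) ⟩
    96 ℕ.* (suc k ! ℕ.* (2 ℕ.* r ℕ.* (2 ℕ.* (n ℕ.∸ ξ) ℕ.* n)))  ≡⟨ right 96 (suc k !) r (n ℕ.∸ ξ) n ⟩
    384 ℕ.* V                                           ∎
    where
    open ℕ.≤-Reasoning
    g≤2r : g ℕ.≤ 2 ℕ.* r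
    g≤2r = ℕ.+-mono-≤ 1≤r (ℕ.≤-reflexive (sym (ℕ.+-identityʳ r)))
    ξ≤n : ξ ℕ.≤ n
    ξ≤n = ℕ.≤-trans (ℕ.m≤n*m ξ 2) 2ξ≤n
    n≤ : n ℕ.≤ 2 ℕ.* (n ℕ.∸ ξ)
    n≤ = ℕ.+-cancelʳ-≤ (2 ℕ.* ξ) _ _ (begin
      n ℕ.+ 2 ℕ.* ξ                     ≤⟨ ℕ.+-monoʳ-≤ n 2ξ≤n ⟩
      n ℕ.+ n                           ≡⟨ cong (n ℕ.+_) (ℕ.+-identityʳ n) ⟨
      2 ℕ.* n                           ≡⟨ cong (2 ℕ.*_) (ℕ.m∸n+n≡m ξ≤n) ⟨
      2 ℕ.* (n ℕ.∸ ξ ℕ.+ ξ)             ≡⟨ ℕ.*-distribˡ-+ 2 (n ℕ.∸ ξ) ξ ⟩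
      2 ℕ.* (n ℕ.∸ ξ) ℕ.+ 2 ℕ.* ξ       ∎)
    left : ∀ a b n K k g → a ℕ.* (n ℕ.* (K ℕ.* (b ℕ.* (k ℕ.* g))) ℕ.* (n ℕ.+ n)) ≡ a ℕ.* b ℕ.* 2 ℕ.* (k ℕ.* K ℕ.* (g ℕ.* (n ℕ.* n)))
    left = solve-∀
    right : ∀ a F r m n → a ℕ.* (F ℕ.* (2 ℕ.* r ℕ.* (2 ℕ.* m ℕ.* n))) ≡ a ℕ.* 4 ℕ.* (r ℕ.* (F ℕ.* (m ℕ.* n)))
    right = solve-∀

  ratio-bound : ∀ {δ E T} → 2 ℕ.* ξ ℕ.≤ n → 0ℚ ≤ δ → δ * ℕtoℚ d ≤ ℕtoℚ 2 →
    E ≤ ℕtoℚ (ξ ℕ.* (n ℕ.+ n)) → ℕtoℚ ((n ℕ.∸ ξ) ℕ.* n) ≤ T →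
    constant * δ * δ * ℕtoℚ n * E ≤ ℕtoℚ r * ½ * (ℕtoℚ (suc k !) * T)
  ratio-bound {δ} {E} {T} 2ξ≤n 0≤δ δd≤2 E≤ T≥ = begin
    constant * δ * δ * N * E
      ≤⟨ ℚ.*-monoˡ-≤-nonNeg (constant * δ * δ * N) {{ℚ.nonNegative (*-nonNeg (*-nonNeg (*-nonNeg 0≤c 0≤δ) 0≤δ) (0≤ℕtoℚ n))}} E≤ ⟩
    constant * δ * δ * N * ℕtoℚ (ξ ℕ.* (n ℕ.+ n))
      ≡⟨ cong (constant * δ * δ * N *_) expand ⟩
    constant * δ * δ * N * (K * (D * D) * S * NN)
      ≡⟨ regroup constant δ N K D S NN ⟩
    δ * D * (δ * D) * (constant * (N * (K * S) * NN))
      ≤⟨ ℚ.*-monoʳ-≤-nonNeg (constant * (N * (K * S) * NN)) {{ℚ.nonNegative (*-nonNeg 0≤c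
           (*-nonNeg (*-nonNeg (0≤ℕtoℚ n) (*-nonNeg (0≤ℕtoℚ (k !)) (0≤ℕtoℚ (6 ℕ.* (k ℕ.* g))))) (0≤ℕtoℚ (n ℕ.+ n))))}}
           (*-mono-≤ 0≤δD 0≤δD δd≤2 δd≤2) ⟩
    ℕtoℚ 2 * ℕtoℚ 2 * (constant * (N * (K * S) * NN))
      ≡⟨ cong (λ z → ℕtoℚ 2 * ℕtoℚ 2 * (constant * z)) collect ⟩
    ℕtoℚ 2 * ℕtoℚ 2 * (constant * ℕtoℚ U)
      ≡⟨⟩
    -- 4 is written as ½ · 8 so that the ½ matches the one in the bound r/2 for ln n.
    ½ * ℕtoℚ 8 * (constant * ℕtoℚ U)
      ≡⟨ arrange ½ (ℕtoℚ 8) constant (ℕtoℚ U) ⟩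
    ½ * constant * (ℕtoℚ 8 * ℕtoℚ U)
      ≡⟨ cong (½ * constant *_) (ℕtoℚ-* 8 U) ⟨
    ½ * constant * ℕtoℚ (8 ℕ.* U)
      ≤⟨ ℚ.*-monoˡ-≤-nonNeg (½ * constant) {{ℚ.nonNegative (*-nonNeg (ℚ.nonNegative⁻¹ ½) 0≤c)}} (ℕtoℚ-mono-≤ (integer-comparison 2ξ≤n)) ⟩
    ½ * constant * ℕtoℚ (384 ℕ.* V)
      ≡⟨ cong (½ * constant *_) (ℕtoℚ-* 384 V) ⟩
    ½ * constant * (ℕtoℚ 384 * ℕtoℚ V)
      ≡⟨ arrange′ ½ constant (ℕtoℚ 384) (ℕtoℚ V) ⟩
    ℕtoℚ 384 * constant * (½ * ℕtoℚ V)
      ≡⟨ trans (cong (_* (½ * ℕtoℚ V)) (*-inv (0<ℕtoℚ {384} (s≤s z≤n)))) (ℚ.*-identityˡ _) ⟩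
    ½ * ℕtoℚ V
      ≡⟨ cong (½ *_) (trans (ℕtoℚ-* r _) (cong (ℕtoℚ r *_) (ℕtoℚ-* (suc k !) _))) ⟩
    ½ * (ℕtoℚ r * (F * ℕtoℚ ((n ℕ.∸ ξ) ℕ.* n)))
      ≤⟨ ℚ.*-monoˡ-≤-nonNeg ½ (ℚ.*-monoˡ-≤-nonNeg (ℕtoℚ r) {{ℚ.nonNegative (0≤ℕtoℚ r)}}
           (ℚ.*-monoˡ-≤-nonNeg F {{ℚ.nonNegative (0≤ℕtoℚ (suc k !))}} T≥)) ⟩
    ½ * (ℕtoℚ r * (F * T))
      ≡⟨ arrange″ ½ (ℕtoℚ r) (F * T) ⟩
    ℕtoℚ r * ½ * (F * T) ∎
    where
    open ℚ.≤-Reasoning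
    N = ℕtoℚ n
    K = ℕtoℚ (k !)
    D = ℕtoℚ d
    S = ℕtoℚ (6 ℕ.* (k ℕ.* g))
    NN = ℕtoℚ (n ℕ.+ n)
    F = ℕtoℚ (suc k !)
    0≤c : 0ℚ ≤ constant
    0≤c = ℚ.<⇒≤ constant>0
    0≤δD : 0ℚ ≤ δ * D
    0≤δD = *-nonNeg 0≤δ (0≤ℕtoℚ d)
    expand : ℕtoℚ (ξ ℕ.* (n ℕ.+ n)) ≡ K * (D * D) * S * NN
    expand = trans (ℕtoℚ-* ξ (n ℕ.+ n)) (cong (_* NN) (trans (ℕtoℚ-* (k ! ℕ.* (d ℕ.* d)) (6 ℕ.* (k ℕ.* g)))
      (cong (_* S) (trans (ℕtoℚ-* (k !) (d ℕ.* d)) (cong (K *_) (ℕtoℚ-* d d))))))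
    collect : N * (K * S) * NN ≡ ℕtoℚ U
    collect = sym (trans (ℕtoℚ-* (n ℕ.* (k ! ℕ.* (6 ℕ.* (k ℕ.* g)))) (n ℕ.+ n)) (cong (_* NN)
      (trans (ℕtoℚ-* n _) (cong (N *_) (ℕtoℚ-* (k !) (6 ℕ.* (k ℕ.* g)))))))
    regroup : ∀ c δ N K D S M → c * δ * δ * N * (K * (D * D) * S * M) ≡ δ * D * (δ * D) * (c * (N * (K * S) * M))
    regroup = solveRing-∀ ℚ-ring
    arrange : ∀ h e c x → h * e * (c * x) ≡ h * c * (e * x)
    arrange = solveRing-∀ ℚ-ring
    arrange′ : ∀ h c e y → h * c * (e * y) ≡ e * c * (h * y)
    arrange′ = solveRing-∀ ℚ-ring
    arrange″ : ∀ h r x → h * (r * x) ≡ r * h * x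
    arrange″ = solveRing-∀ ℚ-ring

-- The exponent from which `linear≤2^` applies with M = 2 · `support k d 1`; since `support` is
-- linear in its last argument, this gives 2 ξ ≤ 2^r ≤ n.
threshold : ℕ → ℕ → ℕ
threshold k d = 6 ℕ.+ 2 ℕ.* support k d 1

support-scale : ∀ k d g → support k d g ≡ support k d 1 ℕ.* g
support-scale k d g = lemma (k ! ℕ.* (d ℕ.* d)) k g
  where
  lemma : ∀ a k g → a ℕ.* (6 ℕ.* (k ℕ.* g)) ≡ a ℕ.* (6 ℕ.* (k ℕ.* 1)) ℕ.* g
  lemma = solve-∀

support>0 : ∀ k d g → 0 ℕ.< support (suc k) (suc d) (suc g)
support>0 k d g = ℕ.*-mono-≤ {1} (ℕ.*-mono-≤ {1} (ℕ.>-nonZero⁻¹ (suc k !) {{suc k ℕ.!≢0}}) (s≤s z≤n)) (s≤s z≤n)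

large⇒sparse : ∀ k d r n → 2 ℕ.^ threshold k d ℕ.≤ n → 2 ℕ.^ r ℕ.≤ n → n ℕ.< 2 ℕ.^ suc r →
  (1 ℕ.≤ r) × (2 ℕ.* support k d (suc r) ℕ.≤ n)
large⇒sparse k d r n N≤n lo hi = ℕ.≤-trans (s≤s z≤n) R≤r , (begin
  2 ℕ.* support k d (suc r)             ≡⟨ cong (2 ℕ.*_) (support-scale k d (suc r)) ⟩
  2 ℕ.* (support k d 1 ℕ.* suc r)       ≡⟨ ℕ.*-assoc 2 (support k d 1) (suc r) ⟨
  2 ℕ.* support k d 1 ℕ.* suc r         ≤⟨ linear≤2^ (2 ℕ.* support k d 1) r R≤r ⟩
  2 ℕ.^ r                               ≤⟨ lo ⟩
  n                                     ∎)
  where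
  open ℕ.≤-Reasoning
  R≤r : threshold k d ℕ.≤ r
  R≤r = ℕ.≮⇒≥ λ r<R → ℕ.<⇒≱ hi (ℕ.≤-trans (ℕ.^-monoʳ-≤ 2 r<R) N≤n)

-- Assembly of the instance and the distribution

module Construction (k₀ d′ r n : ℕ) (n<2^ : n ℕ.< 2 ℕ.^ suc r) (2^≤n : 2 ℕ.^ r ℕ.≤ n) (1≤r : 1 ℕ.≤ r)
  (2ξ≤n : 2 ℕ.* support (suc k₀) (suc d′) (suc r) ℕ.≤ n)
  (δ : ℚ) (0<δ : 0ℚ < δ) (1≤δd : 1ℚ ≤ δ * ℕtoℚ (suc d′)) (δd≤2 : δ * ℕtoℚ (suc d′) ≤ ℕtoℚ 2) where

  ξ = support (suc k₀) (suc d′) (suc r)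

  0<ξ : 0 ℕ.< ξ
  0<ξ = support>0 k₀ d′ r

  ξ<n : ξ ℕ.< n
  ξ<n = ℕ.<-≤-trans (ℕ.m<m*n ξ 2 {{ℕ.>-nonZero 0<ξ}} (s≤s (s≤s z≤n))) (ℕ.≤-trans (ℕ.≤-reflexive (ℕ.*-comm ξ 2)) 2ξ≤n)

  P : ℕ → Permutation′ n
  P = proj₁ (uniform-orders (suc k₀) d′ (suc r) n (ℕ.<⇒≤ n<2^))

  open HardInstance n ξ (ℕ.<⇒≤ ξ<n) P public using (I; KPWeight-bounds; OPT≥)

  D : Dist n
  D = prefix (inv (ℕtoℚ ξ)) P ξ

  isDist : IsDist D
  isDist = prefix-isDist P 0<ξ

  uio : UIO (suc k₀) δ D
  uio y y-inj = subst ((1ℚ - δ) * inv (ℕtoℚ (suc k₀ !)) ≤_) (sym (probOf-prefix (inv (ℕtoℚ ξ)) P (Ordered y) ξ))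
    (frequency⇒probability {δ} 1≤δd {h = hits (Ordered y ∘ P) ξ} (ℕ.>-nonZero⁻¹ (suc k₀ !) {{suc k₀ ℕ.!≢0}}) 0<ξ
      (proj₂ (uniform-orders (suc k₀) d′ (suc r) n (ℕ.<⇒≤ n<2^)) y y-inj))

  module _ (O : MWMOracle I) where

    0<OPT : 0ℚ < OPT O
    0<OPT = ℚ.<-≤-trans (0<ℕtoℚ (ℕ.*-mono-≤ {1} {n ℕ.∸ ξ} {1} {n} (ℕ.m<n⇒0<n∸m ξ<n) (ℕ.≤-trans (s≤s z≤n) ξ<n))) (OPT≥ O)

    B : ℚ
    B = ℕtoℚ (ξ ℕ.* (n ℕ.+ n))

    ExpKP-bounds : (0ℚ ≤ ExpKP I O D) × (ExpKP I O D ≤ B)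
    ExpKP-bounds = proj₁ bounds , ℚ.≤-trans (proj₂ bounds)
      (ℚ.≤-reflexive (trans (cong (_* B) (*-inv (0<ℕtoℚ 0<ξ))) (ℚ.*-identityˡ B)))
      where
      bounds : (0ℚ ≤ ExpKP I O D) × (ExpKP I O D ≤ ℕtoℚ ξ * inv (ℕtoℚ ξ) * B)
      bounds = ExpKP-prefix I O (0≤inv (0<ℕtoℚ 0<ξ)) P B ξ (KPWeight-bounds O)

    ratio : LeLn (constant * δ * δ * ℕtoℚ n * ExpKP I O D * inv (ℕtoℚ (suc (suc k₀) !) * OPT O)) n
    ratio = LeLn-half {r = r}
      (*-nonNeg (*-nonNeg (*-nonNeg (*-nonNeg (*-nonNeg (ℚ.<⇒≤ constant>0) 0≤δ) 0≤δ) (0≤ℕtoℚ n)) (proj₁ ExpKP-bounds)) (0≤inv 0<scaledOPT))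
      (*inv-≤ 0<scaledOPT (ratio-bound (suc k₀) (suc d′) r n 1≤r 2ξ≤n 0≤δ δd≤2 (proj₂ ExpKP-bounds) (OPT≥ O)))
      2^≤n
      where
      0≤δ : 0ℚ ≤ δ
      0≤δ = ℚ.<⇒≤ 0<δ
      0<scaledOPT : 0ℚ < ℕtoℚ (suc (suc k₀) !) * OPT O
      0<scaledOPT = *-pos (0<j! (suc (suc k₀))) 0<OPT

mainTheorem19 : Σ ℚ λ c → (0ℚ < c) ×
    (∀ (k : ℕ) → 1 ≤ℕ k → ∀ (δ : ℚ) → 0ℚ < δ → δ < 1ℚ →
    Σ ℕ λ N → ∀ (n : ℕ) → N ≤ℕ n →
    Σ (Instance n) λ I → Σ (Dist n) λ D → IsDist D × UIO k δ D ×
    (∀ (O : MWMOracle I) → (0ℚ < OPT O) ×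
    LeLn (c * δ * δ * ℕtoℚ n * ExpKP I O D * inv (ℕtoℚ (suc k !) * OPT O)) n))
mainTheorem19 = constant , constant>0 , hard
  where
  hard : ∀ (k : ℕ) → 1 ≤ℕ k → ∀ (δ : ℚ) → 0ℚ < δ → δ < 1ℚ →
    Σ ℕ λ N → ∀ (n : ℕ) → N ≤ℕ n →
    Σ (Instance n) λ I → Σ (Dist n) λ D → IsDist D × UIO k δ D ×
    (∀ (O : MWMOracle I) → (0ℚ < OPT O) ×
    LeLn (constant * δ * δ * ℕtoℚ n * ExpKP I O D * inv (ℕtoℚ (suc k !) * OPT O)) n)
  hard (suc k₀) _ δ 0<δ δ<1 = 2 ℕ.^ threshold (suc k₀) d , λ n N≤n →
    let r , lo , hi = log₂-bounds n (ℕ.≤-trans (ℕ.m^n>0 2 (threshold (suc k₀) d)) N≤n)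
        1≤r , 2ξ≤n = large⇒sparse (suc k₀) d r n N≤n lo hi
        module C = Construction k₀ d′ r n hi lo 1≤r 2ξ≤n δ 0<δ 1≤δd δd≤2
    in C.I , C.D , C.isDist , C.uio , λ O → C.0<OPT O , C.ratio O
    where
    inverse : ∃ λ d′ → (1ℚ ≤ δ * ℕtoℚ (suc d′)) × (δ * ℕtoℚ (suc d′) ≤ ℕtoℚ 2)
    inverse = approximate-inverse δ 0<δ δ<1
    d′ = proj₁ inverse
    d = suc d′
    1≤δd = proj₁ (proj₂ inverse)
    δd≤2 = proj₂ (proj₂ inverse)
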